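{- Let $\mathcal{O}$ be the class of all outerplanar graphs. Then (a) $\chi_{\mathrm{pCFo}}(\mathcal{O}) = 5$; (b) $\chi_{\mathrm{pCFc}}(\mathcal{O}) = 3$; (c) $\chi_{\mathrm{pUMo}}(\mathcal{O}) = 5$; (d) $\chi_{\mathrm{pUMc}}(\mathcal{O}) = 5$.
   Context: Graphs are finite and simple. $N(v)$ denotes the open neighborhood of a vertex $v$ and $N[v]=N(v)\cup\{v\}$ its closed neighborhood. Colorings assign to vertices colors from $\{1,\dots,k\}$; a coloring is proper if adjacent vertices receive distinct colors. A pCFo-coloring (resp. pCFc-coloring) of a graph $G$ is a proper coloring of the vertices such that for every vertex $v$ there is at least one color appearing on exactly one vertex of $N(v)$ (resp. $N[v]$). A pUMo-coloring (resp. pUMc-coloring) of $G$ is a proper coloring of the vertices such that for every vertex $v$ the maximum color appearing on $N(v)$ (resp. $N[v]$) appears on exactly one vertex of $N(v)$ (resp. $N[v]$). $\chi_{\mathrm{pCFo}}(G)$, $\chi_{\mathrm{pCFc}}(G)$, $\chi_{\mathrm{pUMo}}(G)$, $\chi_{\mathrm{pUMc}}(G)$ denote the minimum $k$ such that $G$ has a coloring of the corresponding type with $k$ colors. For an invariant $\chi_{.}$ and a graph class $\mathcal{C}$, $\chi_{.}(\mathcal{C}) = \max\{\chi_{.}(G) \mid G \in \mathcal{C}\}$. For the open neighborhood variants (pCFo, pUMo), only graphs without isolated vertices are considered (i.e., the maximum is over graphs in the class having no isolated vertices). -}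

module Defs where

open import Level using (0ℓ)
open import Data.Bool using (Bool; false; T)
open import Data.Fin as Fin using (Fin)
open import Data.Nat using (ℕ; _+_; _*_; _≤_)
open import Data.Nat.GeneralisedArithmetic using (iterate)
open import Data.Product using (∃; ∃!; _×_)
open import Data.Sum using (_⊎_)
open import Function.Bundles using (_⇔_)
open import Function.Definitions using (Surjective)
open import Relation.Binary.Core using (Rel)
open import Relation.Binary.Construct.Closure.ReflexiveTransitive using (Star)
open import Relation.Binary.PropositionalEquality using (_≡_; _≢_; subst)
open import Relation.Unary using (Pred)

record Graph : Set where
  field
    order      : ℕ
    adjacent   : Fin order → Fin order → Bool
    adj-sym    : ∀ u v → adjacent u v ≡ adjacent v u
    adj-irrefl : ∀ v → adjacent v v ≡ false

  Vertex : Set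
  Vertex = Fin order

  Adj : Rel Vertex 0ℓ
  Adj u v = T (adjacent u v)

  N : Vertex → Pred Vertex 0ℓ
  N v u = Adj v u

  N[_] : Vertex → Pred Vertex 0ℓ
  N[ v ] u = u ≡ v ⊎ N v u

  Connected : Rel Vertex 0ℓ
  Connected = Star Adj

open Graph public using (Vertex; Adj)

-- An edge together with a choice of direction, from tail to head.
record Dart (G : Graph) : Set where
  constructor dart
  field
    tail head : Vertex G
    edge      : Adj G tail head

open Dart public

flip : {G : Graph} → Dart G → Dart G
flip {G} (dart u v e) = dart v u (subst T (Graph.adj-sym G u v) e)

NoIsolatedVertices : Pred Graph 0ℓ
NoIsolatedVertices G = (v : Vertex G) → ∃ λ u → Adj G v u

-- The equivalence relation R has exactly k classes: f identifies the
-- quotient by R with Fin k.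
HasClasses : {A : Set} → Rel A 0ℓ → ℕ → Set
HasClasses {A} R k = ∃ λ (f : A → Fin k) →
  Surjective _≡_ _≡_ f × (∀ x y → R x y ⇔ f x ≡ f y)

-- An embedding of G in an oriented surface, given by its rotation system:
-- next d is the dart following d in the cyclic order of the darts leaving
-- tail d.  Since there are finitely many darts, next-cyclic makes next a
-- permutation having one cycle for each non-isolated vertex.
record RotationSystem (G : Graph) : Set where
  open Graph G using (Connected)
  field
    next        : Dart G → Dart G
    next-tail   : ∀ d → tail (next d) ≡ tail d
    next-cyclic : ∀ d d′ → tail d ≡ tail d′ → ∃ λ i → iterate next d i ≡ d′

  -- The dart following d on the boundary walk of the face beside d.
  faceStep : Dart G → Dart G
  faceStep d = next (flip d)

  SameVertex SameEdge SameFace SameComponent : Rel (Dart G) 0ℓ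
  SameVertex    d d′ = tail d ≡ tail d′
  SameEdge      d d′ = d ≡ d′ ⊎ flip d ≡ d′
  SameFace      d d′ = ∃ λ i → iterate faceStep d i ≡ d′
  SameComponent d d′ = Connected (tail d) (tail d′)

  -- Euler's formula V + F = E + 2C, where F counts the faces of each
  -- component drawn on its own sphere (in a common drawing the outer faces
  -- of the components merge into one).  Everything is counted through
  -- darts, so isolated vertices are left out: each would add one to V, F
  -- and C.  As V + F ≤ E + 2 on every component, equality of the totals
  -- says that each component is embedded with genus 0.
  Planar : Set
  Planar = ∃ λ V → ∃ λ E → ∃ λ F → ∃ λ C →
    HasClasses SameVertex V × HasClasses SameEdge E ×
    HasClasses SameFace F × HasClasses SameComponent C ×
    V + F ≡ E + 2 * C

  -- In every component with an edge some face, represented by one of its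
  -- darts o, is incident with all vertices of the component.  These faces
  -- can be made the outer ones, and the components (and the isolated
  -- vertices) then be placed side by side in the plane.
  AllVerticesOnOuterFace : Set
  AllVerticesOnOuterFace = ∀ (d : Dart G) → ∃ λ o → ∀ v → Connected (tail d) v →
    ∃ λ e → SameFace o e × tail e ≡ v

-- G has a plane drawing with all vertices on the boundary of the outer face.
Outerplanar : Pred Graph 0ℓ
Outerplanar G = ∃ λ (ρ : RotationSystem G) →
  RotationSystem.Planar ρ × RotationSystem.AllVerticesOnOuterFace ρ

-- Fin k stands for the ordered set of colours {1, …, k}.
Coloring : Graph → ℕ → Set
Coloring G k = Vertex G → Fin k

Proper : (G : Graph) {k : ℕ} → Coloring G k → Set
Proper G c = ∀ u v → Adj G u v → c u ≢ c v

module _ {V : Set} {k : ℕ} where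
  AppearsOnceOn : (V → Fin k) → Pred V 0ℓ → Fin k → Set
  AppearsOnceOn c S a = ∃! _≡_ λ u → S u × c u ≡ a

  IsMaxColorOn : (V → Fin k) → Pred V 0ℓ → Fin k → Set
  IsMaxColorOn c S a = (∃ λ u → S u × c u ≡ a) × (∀ u → S u → c u Fin.≤ a)

  ConflictFreeOn : (V → Fin k) → Pred V 0ℓ → Set
  ConflictFreeOn c S = ∃ λ a → AppearsOnceOn c S a

  UniqueMaximumOn : (V → Fin k) → Pred V 0ℓ → Set
  UniqueMaximumOn c S = ∃ λ a → IsMaxColorOn c S a × AppearsOnceOn c S a

ColoringType : Set₁
ColoringType = (G : Graph) (k : ℕ) → Pred (Coloring G k) 0ℓ

pCFo pCFc pUMo pUMc : ColoringType
pCFo G k c = Proper G c × (∀ v → ConflictFreeOn c (Graph.N G v))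
pCFc G k c = Proper G c × (∀ v → ConflictFreeOn c (Graph.N[_] G v))
pUMo G k c = Proper G c × (∀ v → UniqueMaximumOn c (Graph.N G v))
pUMc G k c = Proper G c × (∀ v → UniqueMaximumOn c (Graph.N[_] G v))

-- χ P G k: the least number of colours in a coloring of G of type P is k.
χ : ColoringType → Graph → ℕ → Set
χ P G k = ∃ (P G k) × (∀ j → ∃ (P G j) → k ≤ j)

-- χMax P 𝒞 m: the maximum of χ P over the graphs of the class 𝒞 is m.
χMax : ColoringType → Pred Graph 0ℓ → ℕ → Set
χMax P 𝒞 m =
  (∃ λ G → 𝒞 G × χ P G m) ×
  (∀ G → 𝒞 G → ∃ λ k → χ P G k × k ≤ m)

{-# OPTIONS --safe #-}
module Submission where

-- Two edges of a plane graph whose ends alternate on a face give, after contraction, two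
-- vertices that alternate on a face; cutting one of them in two there also cuts the face in two
-- without disconnecting anything, which Euler's inequality V + E + F ≤ D + 2C (for a map with D
-- darts, proved for arbitrary permutations) forbids.  Hence the vertices of a component of an
-- outerplanar graph, in the order of their first visit by the walk around the outer face, carry
-- no two crossing edges, and every interval of this order splits at a vertex into two intervals.
-- Colourings are built along these splittings.  For the unique-maximum colourings an interval is
-- described by the states its two ends can have simultaneously; a finite family of such
-- descriptions, closed under the splitting step, bounds all of them from below.  The lower bounds
-- come from the triangle, the pentagon and a graph with 17 vertices.

open import Defs
open import Data.Product using (_×_)
open import Relation.Unary using (_∩_)
open import Data.Bool as Bool using (Bool; true; false; T; _∧_; _∨_; not; if_then_else_)
open import Data.Bool.ListAction using (any; all)
open import Data.Bool.Properties using (T?; T-irrelevant; T-∧; T-∨; T-≡)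
open import Data.Empty using (⊥)
open import Data.Fin as Fin using (Fin; zero; suc; toℕ; punchIn; punchOut; combine; remQuot; finToFun; funToFin; #_)
open import Data.Fin.Patterns
open import Data.Fin.Properties as Fin using (injective⇒≤; pigeonhole; punchOut-injective; punchOut-punchIn; punchInᵢ≢i; punchOut-cong)
open import Data.List as List using (List; []; _∷_; _++_; allFin; concatMap; filter; foldr; length; map; upTo)
open import Data.List.Membership.Propositional using (_∈_; find; lose)
open import Data.List.Membership.Propositional.Properties
  using (∈-allFin; ∈-filter⁺; ∈-filter⁻; ∈-map⁺; ∈-map⁻; ∈-++⁺ˡ; ∈-++⁺ʳ; ∈-++⁻; ∈-upTo⁺)
open import Data.List.Relation.Unary.All as All using (All; []; _∷_)
open import Data.List.Relation.Unary.All.Properties using (all⁺; all⁻; map⁺)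
open import Data.List.Relation.Unary.Any using (here; there)
open import Data.List.Relation.Unary.Any.Properties using (any⁺; any⁻)
open import Data.Maybe using (Maybe; just; nothing; is-just; _>>=_)
open import Data.Nat as ℕ
  using (ℕ; zero; suc; _+_; _*_; _∸_; _⊔_; _≤_; _<_; _≡ᵇ_; _<ᵇ_; _≤ᵇ_; z≤n; s≤s; NonZero)
open import Data.Nat.DivMod using (_mod_)
open import Data.Nat.GeneralisedArithmetic using (iterate)
open import Data.Nat.Induction using (<-wellFounded)
import Data.Nat.Properties as ℕ
open import Data.Nat.Solver using (module +-*-Solver)
open import Data.Product using (∃; ∃₂; _,_; proj₁; proj₂)
open import Data.Sum using (_⊎_; inj₁; inj₂; [_,_]′)
open import Data.Sum.Properties using (≡-dec)
open import Data.Unit using (⊤; tt)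
open import Data.Vec as Vec using (Vec; []; _∷_; lookup; tabulate; replicate; _[_]≔_)
import Data.Vec.Properties as Vec
open import Function.Base using (_∘_; id)
open import Function.Bundles using (mk⇔; Equivalence)
open import Function.Definitions using (Injective)
open import Induction.WellFounded using (Acc; acc)
open import Level using (0ℓ)
open import Relation.Binary.Construct.Closure.Equivalence as EqC using (EqClosure)
open import Relation.Binary.Construct.Closure.ReflexiveTransitive as Star using (ε; _◅_; _◅◅_)
open import Relation.Binary.Construct.Closure.Symmetric using (fwd; bwd)
open import Relation.Binary.Core using (Rel; _⇒_)
open import Relation.Binary.Definitions using (DecidableEquality; Symmetric; tri<; tri≈; tri>)
  renaming (Decidable to Decidable₂)
open import Relation.Binary.PropositionalEquality
open import Relation.Nullary using (¬_; Dec; yes; no; contradiction; ¬?; does)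
open import Relation.Nullary.Decidable
  using (map′; _×-dec_; _⊎-dec_; _→-dec_; dec-true; dec-false; dec⇒maybe; toWitness)
open import Relation.Unary using (Pred; Decidable; _⊆_)

-- Planarity is given only as an equation between class counts, so there is no curve to argue with.
-- Every topological step has to be a change of these counts under composing a permutation with a
-- transposition, which splits or joins exactly one cycle. The totals over all components suffice: a
-- forbidden cut raises both V and F by one while E, D and C stay fixed, which violates the
-- inequality by two whatever the other components contribute. Arbitrary permutations are needed
-- because contracting an edge leaves fixed points where an edge involution had none. For unique
-- maxima the obstacle is that a vertex sees both sides of a splitting vertex. Its bound and the
-- number of times the bound is attained are therefore carried in the state, and the vertex is
-- settled at the moment it becomes the middle of two intervals. Restricting the states to a short
-- list of kinds is sound for the same reason, and keeps the check small enough to be evaluated by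
-- the type checker.

private variable
  A : Set
  R S : Rel A 0ℓ
  k l : ℕ

-- Counting the classes of finite equivalence relations.

module HasClasses {A : Set} {R : Rel A 0ℓ} {k : ℕ} (R/k : HasClasses R k) where
  class : A → Fin k
  class = proj₁ R/k

  rep : Fin k → A
  rep i = proj₁ (proj₁ (proj₂ R/k) i)

  class-rep : ∀ i → class (rep i) ≡ i
  class-rep i = proj₂ (proj₁ (proj₂ R/k) i) refl

  sound : ∀ {x y} → class x ≡ class y → R x y
  sound = Equivalence.from (proj₂ (proj₂ R/k) _ _)

  complete : ∀ {x y} → R x y → class x ≡ class y
  complete = Equivalence.to (proj₂ (proj₂ R/k) _ _)

  decide : ∀ x y → Dec (R x y)
  decide x y = map′ sound complete (class x Fin.≟ class y)

  rep-class : ∀ x → R (rep (class x)) x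
  rep-class x = sound (class-rep (class x))

hasClasses : (f : A → Fin k) (g : Fin k → A) → (∀ i → f (g i) ≡ i) →
  (∀ {x y} → R x y → f x ≡ f y) → (∀ {x y} → f x ≡ f y → R x y) → HasClasses R k
hasClasses f g fg≡id to from =
  f , (λ i → g i , λ { refl → fg≡id i }) , λ x y → mk⇔ to from

classes-cong : R ⇒ S → S ⇒ R → HasClasses R k → HasClasses S k
classes-cong R⇒S S⇒R R/k =
  hasClasses class rep class-rep (complete ∘ S⇒R) (R⇒S ∘ sound)
  where open HasClasses R/k

classes-≤ : R ⇒ S → HasClasses R k → HasClasses S l → l ≤ k
classes-≤ R⇒S R/k S/l = injective⇒≤ {f = R.class ∘ S.rep} λ eq →
  trans (sym (S.class-rep _)) (trans (S.complete (R⇒S (R.sound eq))) (S.class-rep _))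
  where
  module R = HasClasses R/k
  module S = HasClasses S/l

classes-≡ : R ⇒ S → S ⇒ R → HasClasses R k → HasClasses S l → k ≡ l
classes-≡ R⇒S S⇒R R/k S/l = ℕ.≤-antisym (classes-≤ S⇒R S/l R/k) (classes-≤ R⇒S R/k S/l)

Linked : Rel A 0ℓ → A → A → Rel A 0ℓ
Linked S p r x y = S x y ⊎ (p ≡ x × r ≡ y)

link : {S : Rel A 0ℓ} {p r : A} → EqClosure (Linked S p r) p r
link = fwd (inj₂ (refl , refl)) ◅ ε

generated : {S : Rel A 0ℓ} → (∀ {x y} → S x y → EqClosure R x y) → EqClosure S ⇒ EqClosure R
generated {R = R} S⇒R = EqC.fold (EqC.isEquivalence R) S⇒R

private
  symm : {S : Rel A 0ℓ} {x y : A} → EqClosure S x y → EqClosure S y x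
  symm {S = S} = EqC.symmetric S

widen : {S : Rel A 0ℓ} {p r : A} → EqClosure S ⇒ EqClosure (Linked S p r)
widen = EqC.map inj₁

linked-absorb : {S : Rel A 0ℓ} {p r : A} → EqClosure S p r → EqClosure (Linked S p r) ⇒ EqClosure S
linked-absorb pr = generated λ { (inj₁ s) → fwd s ◅ ε ; (inj₂ (refl , refl)) → pr }

module _ {S : Rel A 0ℓ} {k : ℕ} (S/k : HasClasses (EqClosure S) k) (p r : A) where
  private open module S = HasClasses S/k

  data LinkedClasses : Set where
    absorbed  : EqClosure S p r → HasClasses (EqClosure (Linked S p r)) k → LinkedClasses
    joined : ∀ {l} → ¬ EqClosure S p r → HasClasses (EqClosure (Linked S p r)) l → k ≡ suc l → LinkedClasses

  opaque
    linkedClasses : LinkedClasses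
    linkedClasses with S.decide p r
    ... | yes pr = absorbed pr (classes-cong widen (linked-absorb pr) S/k)
    ... | no ¬pr = merged S/k ¬pr
      where
      merged : ∀ {k} (S/k : HasClasses (EqClosure S) k) → ¬ EqClosure S p r → LinkedClasses
      merged {zero} S/k _ with () ← proj₁ S/k p
      merged {suc l} S/k′ ¬pr = joined ¬pr (hasClasses g (M.rep ∘ punchIn (M.class r)) g-onto to from) k≡
        where
        module M = HasClasses S/k′
        k≡ : k ≡ suc l
        k≡ = classes-≡ id id S/k S/k′
        redirect : Fin (suc l) → Fin (suc l)
        redirect i with i Fin.≟ M.class r
        ... | yes _ = M.class p
        ... | no  _ = i
        redirect≢ : ∀ i → M.class r ≢ redirect i
        redirect≢ i with i Fin.≟ M.class r
        ... | yes _ = ¬pr ∘ M.sound ∘ sym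
        ... | no i≢ = i≢ ∘ sym
        redirect-no : ∀ {i} → M.class r ≢ i → redirect i ≡ i
        redirect-no {i} i≢ with i Fin.≟ M.class r
        ... | yes i≡ = contradiction (sym i≡) i≢
        ... | no _ = refl
        redirect-r : redirect (M.class r) ≡ M.class p
        redirect-r with M.class r Fin.≟ M.class r
        ... | yes _ = refl
        ... | no r≢r = contradiction refl r≢r
        g : A → Fin l
        g x = punchOut (redirect≢ (M.class x))
        g-cong : ∀ {x y} → redirect (M.class x) ≡ redirect (M.class y) → g x ≡ g y
        g-cong eq = punchOut-cong (M.class r) eq
        g-onto : ∀ i → g (M.rep (punchIn (M.class r) i)) ≡ i
        g-onto i = trans (punchOut-cong (M.class r) {i≢k = punchInᵢ≢i _ i ∘ sym}
            (trans (cong redirect (M.class-rep _)) (redirect-no (punchInᵢ≢i _ i ∘ sym))))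
          (punchOut-punchIn (M.class r))
        to : ∀ {x y} → EqClosure (Linked S p r) x y → g x ≡ g y
        to = EqC.gfold isEquivalence g λ where
          (inj₁ s) → g-cong (cong redirect (M.complete (fwd s ◅ ε)))
          (inj₂ (refl , refl)) → g-cong (trans (redirect-no (¬pr ∘ M.sound ∘ sym)) (sym redirect-r))
        redirected : ∀ {x z} → redirect (M.class x) ≡ M.class z → EqClosure (Linked S p r) x z
        redirected {x} eq with M.class x Fin.≟ M.class r
        ... | yes x≡r = widen (M.sound x≡r) ◅◅ symm link ◅◅ widen (M.sound eq)
        ... | no _ = widen (M.sound eq)
        from : ∀ {x y} → g x ≡ g y → EqClosure (Linked S p r) x y
        from {x} {y} eq = redirected {x} (sym (M.class-rep _)) ◅◅
          symm (redirected {y} (trans (sym (punchOut-injective (redirect≢ (M.class x)) (redirect≢ (M.class y)) eq)) (sym (M.class-rep _))))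

Listed : List (A × A) → Rel A 0ℓ
Listed ps x y = (x , y) ∈ ps

module Finite {A : Set} {n : ℕ} (A/n : HasClasses {A} _≡_ n) where
  private module A = HasClasses A/n

  opaque
    -- The pairs are added one at a time to the discrete partition, so the closure becomes decidable
    -- without any search for paths.
    listedClasses : ∀ ps → ∃ (HasClasses (EqClosure (Listed {A} ps)))
    listedClasses [] = n , classes-cong (λ { refl → ε }) (EqC.fold isEquivalence λ ()) A/n
    listedClasses ((p , r) ∷ ps) with listedClasses ps
    ... | k , S/k = linked (linkedClasses S/k p r)
      where
      relist : ∀ {l} → HasClasses (EqClosure (Linked (Listed ps) p r)) l →
        HasClasses (EqClosure (Listed ((p , r) ∷ ps))) l
      relist = classes-cong
        (EqC.map λ { (inj₁ s) → there s ; (inj₂ (refl , refl)) → here refl })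
        (EqC.map λ { (there s) → inj₁ s ; (here refl) → inj₂ (refl , refl) })
      linked : LinkedClasses S/k p r → ∃ (HasClasses (EqClosure (Listed ((p , r) ∷ ps))))
      linked (absorbed _ S/k′)    = _ , relist S/k′
      linked (joined _ S/l _) = _ , relist S/l

-- Least witnesses, iterates and orbits.

module _ {P : Pred ℕ 0ℓ} (P? : Decidable P) where

  Least : ℕ → Set
  Least i = P i × (∀ j → j < i → ¬ P j)

  private
    search : ∀ i d → (∀ j → j < i → ¬ P j) → P (i + d) → ∃ Least
    search i d below P-i+d with P? i
    ... | yes Pi = i , Pi , below
    search i zero below P-i | no ¬Pi = contradiction (subst P (ℕ.+-identityʳ i) P-i) ¬Pi
    search i (suc d) below P-i+d | no ¬Pi = search (suc i) d below′ (subst P (ℕ.+-suc i d) P-i+d)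
      where
      below′ : ∀ j → j < suc i → ¬ P j
      below′ j j<1+i with ℕ.m≤n⇒m<n∨m≡n (ℕ.s≤s⁻¹ j<1+i)
      ... | inj₁ j<i = below j j<i
      ... | inj₂ refl = ¬Pi

  least : ∀ i → P i → ∃ Least
  least i = search 0 i (λ _ ())

module _ {A : Set} (π : A → A) where

  iterate-suc : ∀ x i → iterate π x (suc i) ≡ π (iterate π x i)
  iterate-suc x zero = refl
  iterate-suc x (suc i) = iterate-suc (π x) i

  iterate-+ : ∀ x i j → iterate π x (i + j) ≡ iterate π (iterate π x i) j
  iterate-+ x zero j = refl
  iterate-+ x (suc i) j = iterate-+ (π x) i j

  iterate-injective : Injective _≡_ _≡_ π → ∀ i → Injective _≡_ _≡_ (λ x → iterate π x i)
  iterate-injective inj zero eq = eq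
  iterate-injective inj (suc i) eq = inj (iterate-injective inj i eq)

  Graphᶠ : Rel A 0ℓ
  Graphᶠ x y = π x ≡ y

  infix 4 _∼_
  _∼_ : Rel A 0ℓ
  _∼_ = EqClosure Graphᶠ

  ∼-step : ∀ x → x ∼ π x
  ∼-step x = fwd refl ◅ ε

  ∼-iterate : ∀ x i → x ∼ iterate π x i
  ∼-iterate x zero = ε
  ∼-iterate x (suc i) = fwd refl ◅ ∼-iterate (π x) i

  ∼-sym : ∀ {x y} → x ∼ y → y ∼ x
  ∼-sym = EqC.symmetric Graphᶠ

  ∼-invariant : ∀ {B : Set} (g : A → B) → (∀ x → g (π x) ≡ g x) → ∀ {x y} → x ∼ y → g x ≡ g y
  ∼-invariant g gπ≡g = EqC.gfold isEquivalence g λ { refl → sym (gπ≡g _) }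

Joint : {A : Set} → (A → A) → (A → A) → Rel A 0ℓ
Joint σ α x y = σ x ≡ y ⊎ α x ≡ y

-- Transpositions and the cycles of permutations.

module Swap {A : Set} (_≟_ : DecidableEquality A) where

  opaque
    swap : A → A → A → A
    swap p r x with x ≟ p | x ≟ r
    ... | yes _ | _     = r
    ... | no _  | yes _ = p
    ... | no _  | no _  = x

    swap-left : ∀ p r → swap p r p ≡ r
    swap-left p r with p ≟ p
    ... | yes _ = refl
    ... | no p≢p = contradiction refl p≢p

    swap-right : ∀ p r → swap p r r ≡ p
    swap-right p r with r ≟ p | r ≟ r
    ... | yes r≡p | _ = r≡p
    ... | no _ | yes _ = refl
    ... | no _ | no r≢r = contradiction refl r≢r

    swap-other : ∀ {p r x} → x ≢ p → x ≢ r → swap p r x ≡ x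
    swap-other {p} {r} {x} x≢p x≢r with x ≟ p | x ≟ r
    ... | yes x≡p | _ = contradiction x≡p x≢p
    ... | no _ | yes x≡r = contradiction x≡r x≢r
    ... | no _ | no _ = refl

  data SwapView (p r : A) : A → Set where
    at-left : SwapView p r p
    at-right : SwapView p r r
    elsewhere : ∀ {x} → x ≢ p → x ≢ r → SwapView p r x

  swapView : ∀ p r x → SwapView p r x
  swapView p r x with x ≟ p | x ≟ r
  ... | yes refl | _ = at-left
  ... | no _ | yes refl = at-right
  ... | no x≢p | no x≢r = elsewhere x≢p x≢r

  swap-involutive : ∀ p r x → swap p r (swap p r x) ≡ x
  swap-involutive p r x with swapView p r x
  ... | at-left = trans (cong (swap p r) (swap-left p r)) (swap-right p r)
  ... | at-right = trans (cong (swap p r) (swap-right p r)) (swap-left p r)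
  ... | elsewhere x≢p x≢r = trans (cong (swap p r) (swap-other x≢p x≢r)) (swap-other x≢p x≢r)

  swap-injective : ∀ p r → Injective _≡_ _≡_ (swap p r)
  swap-injective p r {x} {y} eq =
    trans (sym (swap-involutive p r x)) (trans (cong (swap p r) eq) (swap-involutive p r y))

  -- Moves a transposition from the inside of a composite to the outside, where `split` and `join`
  -- apply.
  swap-conjugate : ∀ {f : A → A} → Injective _≡_ _≡_ f → ∀ p r x → f (swap p r x) ≡ swap (f p) (f r) (f x)
  swap-conjugate {f} f-inj p r x with swapView p r x
  ... | at-left = trans (cong f (swap-left p r)) (sym (swap-left (f p) (f r)))
  ... | at-right = trans (cong f (swap-right p r)) (sym (swap-right (f p) (f r)))
  ... | elsewhere x≢p x≢r = trans (cong f (swap-other x≢p x≢r)) (sym (swap-other (x≢p ∘ f-inj) (x≢r ∘ f-inj)))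

  swap-linked : ∀ {S : Rel A 0ℓ} p r x → EqClosure (Linked S p r) (swap p r x) x
  swap-linked {S} p r x with swapView p r x
  ... | at-left = subst (λ y → EqClosure (Linked S p r) y p) (sym (swap-left p r)) (EqC.symmetric _ link)
  ... | at-right = subst (λ y → EqClosure (Linked S p r) y r) (sym (swap-right p r)) link
  ... | elsewhere x≢p x≢r = subst (λ y → EqClosure (Linked S p r) y x) (sym (swap-other x≢p x≢r)) ε

module Permutations {A : Set} {n : ℕ} (A/n : HasClasses {A} _≡_ n) where
  private module A = HasClasses A/n
  open A using () renaming (decide to _≟_)
  open Swap _≟_ public
  open Finite A/n

  elements : List A
  elements = map A.rep (allFin n)

  ∈-elements : ∀ x → x ∈ elements
  ∈-elements x = subst (_∈ elements) (A.rep-class x) (∈-map⁺ A.rep (∈-allFin (A.class x)))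

  graph : (A → A) → List (A × A)
  graph π = map (λ x → x , π x) elements

  ∈-graph : ∀ π x → (x , π x) ∈ graph π
  ∈-graph π x = ∈-map⁺ _ (∈-elements x)

  graph-∈ : ∀ π {x y} → (x , y) ∈ graph π → π x ≡ y
  graph-∈ π xy∈ with ∈-map⁻ _ xy∈
  ... | _ , _ , refl = refl

  cycles : ∀ π → ∃ (HasClasses (_∼_ π))
  cycles π with listedClasses (graph π)
  ... | k , L/k = k , classes-cong (EqC.map (graph-∈ π)) (EqC.map λ { refl → ∈-graph π _ }) L/k

  jointClasses : ∀ σ α → ∃ (HasClasses (EqClosure (Joint σ α)))
  jointClasses σ α with listedClasses (graph σ ++ graph α)
  ... | k , L/k = k , classes-cong (EqC.map from) (EqC.map to) L/k
    where
    from : ∀ {x y} → (x , y) ∈ graph σ ++ graph α → Joint σ α x y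
    from xy∈ with ∈-++⁻ (graph σ) xy∈
    ... | inj₁ xy∈σ = inj₁ (graph-∈ σ xy∈σ)
    ... | inj₂ xy∈α = inj₂ (graph-∈ α xy∈α)
    to : ∀ {x y} → Joint σ α x y → (x , y) ∈ graph σ ++ graph α
    to (inj₁ refl) = ∈-++⁺ˡ (∈-graph σ _)
    to (inj₂ refl) = ∈-++⁺ʳ (graph σ) (∈-graph α _)

  module _ {π : A → A} (π-inj : Injective _≡_ _≡_ π) where

    opaque
      -- Two of the first `n + 1` iterates coincide, and injectivity cancels their common initial
      -- steps.
      period : ∀ x → ∃ λ i → iterate π x (suc i) ≡ x
      period x with pigeonhole (ℕ.n<1+n n) (λ (i : Fin (suc n)) → A.class (iterate π x (toℕ i)))
      ... | i , j , i<j , eq with ℕ.m≤n⇒∃[o]m+o≡n i<j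
      ...   | d , 1+i+d≡j = d , iterate-injective π π-inj (toℕ i) (begin
        iterate π (iterate π x (suc d)) (toℕ i) ≡⟨ iterate-+ π x (suc d) (toℕ i) ⟨
        iterate π x (suc d + toℕ i)             ≡⟨ cong (iterate π x) (trans (cong suc (ℕ.+-comm d (toℕ i))) 1+i+d≡j) ⟩
        iterate π x (toℕ j)                     ≡⟨ A.sound eq ⟨
        iterate π x (toℕ i)                     ∎)
        where open ≡-Reasoning

    opaque
      -- A backward step is replaced by going forward around the rest of the cycle.
      orbit : ∀ {x y} → _∼_ π x y → ∃ λ i → iterate π x i ≡ y
      orbit ε = 0 , refl
      orbit (fwd refl ◅ x∼y) with orbit x∼y
      ... | i , eq = suc i , eq
      orbit {x} (_◅_ {j = z} (bwd refl) x∼y) with orbit x∼y | period z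
      ... | i , eq | j , πʲ⁺¹z≡z = j + i , trans (iterate-+ π x j i) (trans (cong (λ w → iterate π w i) πʲ⁺¹z≡z) eq)

  module _ {π : A → A} (π-inj : Injective _≡_ _≡_ π) {p r : A} where

    private
      τπ : A → A
      τπ = swap p r ∘ π

      τπ-inj : Injective _≡_ _≡_ τπ
      τπ-inj = π-inj ∘ swap-injective p r

    iterate-swap : ∀ x i → (∀ j → j < i → iterate π x (suc j) ≢ p × iterate π x (suc j) ≢ r) →
      iterate τπ x i ≡ iterate π x i
    iterate-swap x zero _ = refl
    iterate-swap x (suc i) avoids = begin
      iterate τπ (τπ x) i ≡⟨ cong (λ y → iterate τπ y i) (swap-other (proj₁ πx≢) (proj₂ πx≢)) ⟩
      iterate τπ (π x) i  ≡⟨ iterate-swap (π x) i (λ j j<i → avoids (suc j) (s≤s j<i)) ⟩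
      iterate π (π x) i   ∎
      where
      open ≡-Reasoning
      πx≢ = avoids 0 (s≤s z≤n)

    -- The arc of the old cycle that starts at `p` and stops just before `r` is closed under the new
    -- permutation: the step that used to enter `r` now returns to `p`.
    split : p ≢ r → _∼_ π p r → ¬ _∼_ τπ p r
    split p≢r p∼r p∼′r with least (λ i → iterate π p i ≟ r) (proj₁ (orbit π-inj p∼r)) (proj₂ (orbit π-inj p∼r))
    ... | zero , p≡r , _ = p≢r p≡r
    ... | suc j , πʲ⁺¹p≡r , below = r∉ (proj₂ (orbit τπ-inj p∼′r)) (stays (proj₁ (orbit τπ-inj p∼′r)) p (0 , z≤n , refl))
      where
      Before : A → Set
      Before x = ∃ λ i → i ≤ j × iterate π p i ≡ x
      r∉ : ∀ {x} → x ≡ r → ¬ Before x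
      r∉ x≡r (i , i≤j , eq) = below i (s≤s i≤j) (trans eq x≡r)
      step : ∀ {x} → Before x → Before (τπ x)
      step (i , i≤j , refl) with ℕ.m≤n⇒m<n∨m≡n i≤j
      ... | inj₂ refl = 0 , z≤n ,
        sym (trans (cong (swap p r) (trans (sym (iterate-suc π p i)) πʲ⁺¹p≡r)) (swap-right p r))
      ... | inj₁ i<j = suc i , i<j ,
        sym (trans (cong (swap p r) (sym (iterate-suc π p i))) (swap-other ≢p (below (suc i) (s≤s i<j))))
        where
        open ≡-Reasoning
        -- A return to `p` after `i + 1` steps would let `r` appear already at step `j ∸ i`.
        ≢p : iterate π p (suc i) ≢ p
        ≢p return = below (j ∸ i) (s≤s (ℕ.m∸n≤m j i)) (begin
          iterate π p (j ∸ i)                       ≡⟨ cong (λ x → iterate π x (j ∸ i)) return ⟨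
          iterate π (iterate π p (suc i)) (j ∸ i)   ≡⟨ iterate-+ π p (suc i) (j ∸ i) ⟨
          iterate π p (suc (i + (j ∸ i)))           ≡⟨ cong (iterate π p ∘ suc) (ℕ.m+[n∸m]≡n i≤j) ⟩
          iterate π p (suc j)                       ≡⟨ πʲ⁺¹p≡r ⟩
          r                                         ∎)
      stays : ∀ i x → Before x → Before (iterate τπ x i)
      stays zero x b = b
      stays (suc i) x b = stays i (τπ x) (step b)

    -- The old cycle of `p` avoids `r`, so the new permutation follows it until the closing step,
    -- which is diverted from `p` to `r`.
    join : ¬ _∼_ π p r → _∼_ τπ p r
    join p≁r with least (λ i → iterate π p (suc i) ≟ p) (proj₁ (period π-inj p)) (proj₂ (period π-inj p))
    ... | i , πⁱ⁺¹p≡p , below = subst (_∼_ τπ p) τπⁱ⁺¹p≡r (∼-iterate τπ p (suc i))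
      where
      open ≡-Reasoning
      avoids : ∀ j → j < i → iterate π p (suc j) ≢ p × iterate π p (suc j) ≢ r
      avoids j j<i = below j j<i , λ eq → p≁r (subst (_∼_ π p) eq (∼-iterate π p (suc j)))
      τπⁱ⁺¹p≡r : iterate τπ p (suc i) ≡ r
      τπⁱ⁺¹p≡r = begin
        iterate τπ p (suc i)           ≡⟨ iterate-suc τπ p i ⟩
        swap p r (π (iterate τπ p i))  ≡⟨ cong τπ (iterate-swap p i avoids) ⟩
        swap p r (π (iterate π p i))   ≡⟨ cong (swap p r) (iterate-suc π p i) ⟨
        swap p r (iterate π p (suc i)) ≡⟨ cong (swap p r) πⁱ⁺¹p≡p ⟩
        swap p r p                     ≡⟨ swap-left p r ⟩
        r                              ∎

    -- Once `p` and `r` are identified, both permutations generate the same relation. The class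
    -- counts before and after are compared through this common coarsening.
    swap-graph : EqClosure (Linked (Graphᶠ τπ) p r) ⇒ EqClosure (Linked (Graphᶠ π) p r)
    swap-graph = generated λ
      { (inj₁ refl) → widen (∼-step π _) ◅◅ EqC.symmetric _ (swap-linked p r _)
      ; (inj₂ (refl , refl)) → link }

    swap-graph⁻ : EqClosure (Linked (Graphᶠ π) p r) ⇒ EqClosure (Linked (Graphᶠ τπ) p r)
    swap-graph⁻ = generated λ
      { (inj₁ refl) → widen (∼-step τπ _) ◅◅ swap-linked p r _
      ; (inj₂ (refl , refl)) → link }

    split-classes : p ≢ r → _∼_ π p r → HasClasses (_∼_ π) k → HasClasses (_∼_ τπ) l → l ≡ suc k
    split-classes p≢r p∼r π/k τπ/l with linkedClasses τπ/l p r
    ... | absorbed p∼′r _ = contradiction p∼′r (split p≢r p∼r)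
    ... | joined _ linked/m refl = cong suc
      (classes-≡ (linked-absorb p∼r ∘ swap-graph) (swap-graph⁻ ∘ widen) linked/m π/k)

    join-classes : ¬ _∼_ π p r → HasClasses (_∼_ π) k → HasClasses (_∼_ τπ) l → k ≡ suc l
    join-classes p≁r π/k τπ/l with linkedClasses π/k p r
    ... | absorbed p∼r _ = contradiction p∼r p≁r
    ... | joined _ linked/m refl = cong suc
      (classes-≡ (linked-absorb (join p≁r) ∘ swap-graph⁻) (swap-graph ∘ widen) linked/m τπ/l)

    swap-classes-≤ : HasClasses (_∼_ π) k → HasClasses (_∼_ τπ) l → l ≤ suc k
    swap-classes-≤ π/k τπ/l with linkedClasses τπ/l p r
    ... | absorbed _ linked/l = ℕ.m≤n⇒m≤1+n (classes-≤ (swap-graph⁻ ∘ widen) π/k linked/l)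
    ... | joined _ linked/m refl = s≤s (classes-≤ (swap-graph⁻ ∘ widen) π/k linked/m)

∼-cong : {A : Set} {π ρ : A → A} → π ≗ ρ → _∼_ π ⇒ _∼_ ρ
∼-cong π≗ρ = EqC.map λ { refl → sym (π≗ρ _) }

-- Euler's inequality and alternating corners of a face.

module Euler {A : Set} {n : ℕ} (A/n : HasClasses {A} _≡_ n) where
  private module A = HasClasses A/n
  open A using () renaming (decide to _≟_)
  open Permutations A/n

  joint-σ : ∀ {σ α : A → A} x → EqClosure (Joint σ α) x (σ x)
  joint-σ x = fwd (inj₁ refl) ◅ ε

  joint-α : ∀ {σ α : A → A} x → EqClosure (Joint σ α) x (α x)
  joint-α x = fwd (inj₂ refl) ◅ ε

  joint-φ : ∀ {σ α : A → A} → _∼_ (σ ∘ α) ⇒ EqClosure (Joint σ α)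
  joint-φ = generated λ { refl → joint-α _ ◅◅ joint-σ _ }

  joint-sym : ∀ {σ α : A → A} {x y} → EqClosure (Joint σ α) x y → EqClosure (Joint σ α) y x
  joint-sym = EqC.symmetric _

  swap-absorb : ∀ {S : Rel A 0ℓ} {p r} → EqClosure S p r → ∀ x → EqClosure S (swap p r x) x
  swap-absorb pr x = linked-absorb pr (swap-linked _ _ x)

  -- Undoing the transposition (x α(x)) of α frees the fixed point x; it changes the number of
  -- cycles of σ ∘ α by one, and it increases that number if it disconnects x from α(x).
  euler-≤ : ∀ {s a f c} {σ α : A → A} → Injective _≡_ _≡_ σ → Injective _≡_ _≡_ α →
    HasClasses (_∼_ σ) s → HasClasses (_∼_ α) a →
    HasClasses (_∼_ (σ ∘ α)) f → HasClasses (EqClosure (Joint σ α)) c →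
    s + a + f ≤ n + 2 * c
  euler-≤ {s} {a} {f} {c} {σ} {α} σ-inj α-inj σ/s α/a φ/f J/c = go n α-inj α/a φ/f J/c (ℕ.m≤n+m n a)
    where
    -- Each call raises the number `a` of cycles of `α` by one, and this number never exceeds `n`;
    -- hence the bound on `fuel`.
    go : ∀ fuel {α a f c} → Injective _≡_ _≡_ α → HasClasses (_∼_ α) a →
      HasClasses (_∼_ (σ ∘ α)) f → HasClasses (EqClosure (Joint σ α)) c →
      n ≤ a + fuel → s + a + f ≤ n + 2 * c
    go fuel {α} {a} {f} {c} α-inj α/a φ/f J/c n≤
      with Fin.any? (λ i → ¬? (α (A.rep i) ≟ A.rep i))
    -- With `α` the identity, `σ`, `σ ∘ α` and the joint relation all have the same classes, and
    -- equality holds.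
    ... | no ¬moved = ℕ.≤-reflexive (begin
      s + a + f   ≡⟨ cong₂ _+_ (cong₂ _+_ s≡c a≡n) f≡c ⟩
      c + n + c   ≡⟨ solve 2 (λ n c → c :+ n :+ c := n :+ con 2 :* c) refl n c ⟩
      n + 2 * c   ∎)
      where
      open ≡-Reasoning
      open +-*-Solver
      fixed : ∀ x → α x ≡ x
      fixed x with α x ≟ x
      ... | yes αx≡x = αx≡x
      ... | no αx≢x = contradiction (A.class x , subst (λ y → α y ≢ y) (sym (A.rep-class x)) αx≢x) ¬moved
      a≡n : a ≡ n
      a≡n = classes-≡ (∼-invariant α id fixed) (λ { refl → ε }) α/a A/n
      s≡c : s ≡ c
      s≡c = classes-≡ (EqC.map inj₁)
        (generated λ { (inj₁ refl) → ∼-step σ _ ; (inj₂ refl) → subst (_∼_ σ _) (sym (fixed _)) ε }) σ/s J/c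
      f≡c : f ≡ c
      f≡c = classes-≡ joint-φ (generated λ
        { (inj₁ refl) → subst (λ y → _∼_ (σ ∘ α) _ (σ y)) (fixed _) (∼-step (σ ∘ α) _)
        ; (inj₂ refl) → subst (_∼_ (σ ∘ α) _) (sym (fixed _)) ε }) φ/f J/c
    ... | yes (i , αx≢x) = moved fuel n≤
      where
      x = A.rep i
      α′ : A → A
      α′ = swap x (α x) ∘ α
      φ′ : A → A
      φ′ = σ ∘ α′
      α′-inj : Injective _≡_ _≡_ α′
      α′-inj = α-inj ∘ swap-injective x (α x)
      φ′-inj : Injective _≡_ _≡_ φ′
      φ′-inj = α′-inj ∘ σ-inj
      φ≗ : swap (σ x) (σ (α x)) ∘ φ′ ≗ σ ∘ α
      φ≗ y = trans (sym (swap-conjugate σ-inj x (α x) (α′ y))) (cong σ (swap-involutive x (α x) (α y)))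
      φ/f′ : HasClasses (_∼_ (swap (σ x) (σ (α x)) ∘ φ′)) f
      φ/f′ = classes-cong (∼-cong (sym ∘ φ≗)) (∼-cong φ≗) φ/f
      J′⇒J : EqClosure (Linked (Joint σ α′) x (α x)) ⇒ EqClosure (Joint σ α)
      J′⇒J = generated λ
        { (inj₁ (inj₁ refl)) → joint-σ _
        ; (inj₁ (inj₂ refl)) → joint-α _ ◅◅ joint-sym (swap-absorb (joint-α x) _)
        ; (inj₂ (refl , refl)) → joint-α x }
      J⇒J′ : EqClosure (Joint σ α) ⇒ EqClosure (Linked (Joint σ α′) x (α x))
      J⇒J′ = generated λ
        { (inj₁ refl) → widen (joint-σ _)
        ; (inj₂ refl) → widen (joint-α _) ◅◅ swap-linked x (α x) _ }
      step : ∀ {f′ c′} → HasClasses (_∼_ φ′) f′ → (J′/c′ : HasClasses (EqClosure (Joint σ α′)) c′) →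
        s + suc a + f′ ≤ n + 2 * c′ → LinkedClasses J′/c′ x (α x) → s + a + f ≤ n + 2 * c
      step {f′} {c′} φ′/f′ J′/c′ ih (absorbed x∼αx linked/c′) = begin
        s + a + f          ≤⟨ ℕ.+-monoʳ-≤ (s + a) (swap-classes-≤ φ′-inj φ′/f′ φ/f′) ⟩
        s + a + suc f′     ≡⟨ solve 3 (λ s a f → s :+ a :+ (con 1 :+ f) := s :+ (con 1 :+ a) :+ f) refl s a f′ ⟩
        s + suc a + f′     ≤⟨ ih ⟩
        n + 2 * c′         ≡⟨ cong (λ c → n + 2 * c) (classes-≡ J′⇒J J⇒J′ linked/c′ J/c) ⟩
        n + 2 * c          ∎
        where
        open ℕ.≤-Reasoning
        open +-*-Solver
      step {f′} {c′} φ′/f′ J′/c′ ih (joined x≁αx linked/l c′≡1+l) = ℕ.s≤s⁻¹ (ℕ.s≤s⁻¹ (begin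
        2 + (s + a + f)    ≡⟨ solve 3 (λ s a f → con 2 :+ (s :+ a :+ f) := s :+ (con 1 :+ a) :+ (con 1 :+ f)) refl s a f ⟩
        s + suc a + suc f  ≡⟨ cong (s + suc a +_) f′≡1+f ⟨
        s + suc a + f′     ≤⟨ ih ⟩
        n + 2 * c′         ≡⟨ cong (λ c → n + 2 * c) (trans c′≡1+l (cong suc (classes-≡ J′⇒J J⇒J′ linked/l J/c))) ⟩
        n + 2 * suc c      ≡⟨ solve 2 (λ n c → n :+ con 2 :* (con 1 :+ c) := con 2 :+ (n :+ con 2 :* c)) refl n c ⟩
        2 + (n + 2 * c)    ∎))
        where
        open ℕ.≤-Reasoning
        open +-*-Solver
        -- A common face of `σ x` and `σ (α x)` under `φ′` would connect `x` with `α x` without the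
        -- removed link; so restoring the transposition joins two faces.
        f′≡1+f : f′ ≡ suc f
        f′≡1+f = join-classes φ′-inj
          (λ σx∼σαx → x≁αx (joint-σ x ◅◅ joint-φ σx∼σαx ◅◅ joint-sym (joint-σ (α x)))) φ′/f′ φ/f′
      moved : ∀ fuel → n ≤ a + fuel → s + a + f ≤ n + 2 * c
      moved fuel n≤ with cycles α′ | cycles φ′ | jointClasses σ α′
      ... | a′ , α′/a′ | f′ , φ′/f′ | c′ , J′/c′ with split-classes α-inj (αx≢x ∘ sym) (∼-step α x) α/a α′/a′
      moved zero n≤a+0 | _ , α′/a′ | _ | _ | refl =
        contradiction (ℕ.≤-trans (classes-≤ (λ { refl → ε }) A/n α′/a′) n≤a+0) (ℕ.<-irrefl (sym (ℕ.+-identityʳ a)))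
      moved (suc fuel) n≤a+1+fuel | _ , α′/a′ | f′ , φ′/f′ | c′ , J′/c′ | refl = step φ′/f′ J′/c′
        (go fuel α′-inj α′/a′ φ′/f′ J′/c′ (subst (n ≤_) (ℕ.+-suc a fuel) n≤a+1+fuel))
        (linkedClasses J′/c′ x (α x))

  -- If `α` is an involution without fixed points then `n` is twice `edges`, and `euler` is the
  -- usual V + F = E + 2C. This form also makes sense for the fixed points that contraction creates.
  record Genus0 (σ α : A → A) : Set where
    field
      {vertices edges faces components} : ℕ
      σ-injective : Injective _≡_ _≡_ σ
      α-injective : Injective _≡_ _≡_ α
      σ-classes   : HasClasses (_∼_ σ) vertices
      α-classes   : HasClasses (_∼_ α) edges
      φ-classes   : HasClasses (_∼_ (σ ∘ α)) faces
      classes     : HasClasses (EqClosure (Joint σ α)) components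
      euler       : vertices + edges + faces ≡ n + 2 * components

  module _ {σ α : A → A} (G : Genus0 σ α) where
    open Genus0 G

    -- Splitting the vertex of p and r at these two corners would split the face as well,
    -- but the path p, q, t, r keeps the component connected: this contradicts euler-≤.
    noncrossing-orbits : ∀ {p r} i j → let φ = σ ∘ α ; q = iterate φ p i ; t = iterate φ r j in
      p ≢ r → _∼_ φ p r →
      (∀ k → k < i → iterate φ p (suc k) ≢ p × iterate φ p (suc k) ≢ r) →
      (∀ k → k < j → iterate φ r (suc k) ≢ p × iterate φ r (suc k) ≢ r) →
      _∼_ σ p r → _∼_ σ q t → _∼_ σ p q
    noncrossing-orbits {p} {r} i j p≢r p∼r avoid-p avoid-r p∼σr q∼σt with HasClasses.decide σ-classes p q
      where
      φ : A → A
      φ = σ ∘ α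
      q = iterate φ p i
    ... | yes p∼σq = p∼σq
    ... | no p≁σq = contradiction impossible (ℕ.<-irrefl euler)
      where
      φ σ′ φ′ : A → A
      φ = σ ∘ α
      σ′ = swap p r ∘ σ
      φ′ = swap p r ∘ φ
      φ-inj : Injective _≡_ _≡_ φ
      φ-inj = α-injective ∘ σ-injective
      q = iterate φ p i
      t = iterate φ r j
      -- The face walks from `p` to `q` and from `r` to `t` never arrive at `p` or `r`, so the cut
      -- leaves them intact.
      p∼q : EqClosure (Joint σ′ α) p q
      p∼q = joint-φ (subst (_∼_ φ′ p) (iterate-swap φ-inj p i avoid-p) (∼-iterate φ′ p i))
      r∼t : EqClosure (Joint σ′ α) r t
      r∼t = joint-φ (subst (_∼_ φ′ r) (iterate-swap φ-inj r j avoid-r) (∼-iterate φ′ r j))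
      -- If `q` is not at the vertex of `p` and `r`, its whole `σ`-orbit misses the two corners
      -- where the cut is made.
      q∼t : EqClosure (Joint σ′ α) q t
      q∼t with orbit σ-injective q∼σt
      ... | k , eq = EqC.map inj₁ (subst (_∼_ σ′ q)
        (trans (iterate-swap σ-injective q k (λ l _ → ≢p l , ≢r l)) eq) (∼-iterate σ′ q k))
        where
        ≢p : ∀ l → iterate σ q (suc l) ≢ p
        ≢p l eq = p≁σq (∼-sym σ (subst (_∼_ σ q) eq (∼-iterate σ q (suc l))))
        ≢r : ∀ l → iterate σ q (suc l) ≢ r
        ≢r l eq = p≁σq (p∼σr ◅◅ ∼-sym σ (subst (_∼_ σ q) eq (∼-iterate σ q (suc l))))
      p∼r′ : EqClosure (Joint σ′ α) p r
      p∼r′ = p∼q ◅◅ q∼t ◅◅ joint-sym r∼t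
      joint′ : HasClasses (EqClosure (Joint σ′ α)) components
      joint′ = classes-cong
        (generated λ { (inj₁ refl) → joint-σ _ ◅◅ swap-absorb p∼r′ _ ; (inj₂ refl) → joint-α _ })
        (generated λ
          { (inj₁ refl) → joint-σ _ ◅◅ joint-sym (swap-absorb (EqC.map inj₁ p∼σr) _)
          ; (inj₂ refl) → joint-α _ })
        classes
      vertices′ = cycles σ′
      faces′ = cycles φ′
      impossible : vertices + edges + faces < n + 2 * components
      impossible = begin-strict
        vertices + edges + faces         <⟨ ℕ.+-mono-< (ℕ.n<1+n (vertices + edges)) (ℕ.n<1+n faces) ⟩
        suc vertices + edges + suc faces ≡⟨ cong₂ (λ v f → v + edges + f)
          (split-classes σ-injective p≢r p∼σr σ-classes (proj₂ vertices′))
          (split-classes φ-inj p≢r p∼r φ-classes (proj₂ faces′)) ⟨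
        proj₁ vertices′ + edges + proj₁ faces′ ≤⟨ euler-≤ (σ-injective ∘ swap-injective p r) α-injective
          (proj₂ vertices′) α-classes (proj₂ faces′) joint′ ⟩
        n + 2 * components               ∎
        where open ℕ.≤-Reasoning

  -- Contraction and the exclusion of crossing edges.

  -- The map with the edge {d , α d} contracted; its two darts become fixed points of α.
  module Contract {σ α : A → A} (G : Genus0 σ α) {d : A} (d≁αd : ¬ _∼_ σ d (α d)) where
    open Genus0 G

    σ′ α′ : A → A
    σ′ = σ ∘ swap d (α d)
    α′ = swap d (α d) ∘ α

    -- The same transposition is put on the right of `σ` and on the left of `α`, so it cancels. Face
    -- walks survive contraction step by step, with unchanged step counts.
    φ′≗φ : σ′ ∘ α′ ≗ σ ∘ α
    φ′≗φ x = cong σ (swap-involutive d (α d) (α x))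

    private
      σ″ : A → A
      σ″ = swap (σ d) (σ (α d)) ∘ σ

      σ′≗σ″ : σ′ ≗ σ″
      σ′≗σ″ = swap-conjugate σ-injective d (α d)

      σd≁σαd : ¬ _∼_ σ (σ d) (σ (α d))
      σd≁σαd σd∼σαd = d≁αd (∼-step σ d ◅◅ σd∼σαd ◅◅ ∼-sym σ (∼-step σ (α d)))

      σ′-swap : ∀ x → _∼_ σ′ (swap d (α d) x) (σ x)
      σ′-swap x = subst (_∼_ σ′ (swap d (α d) x)) (cong σ (swap-involutive d (α d) x)) (∼-step σ′ _)

    merged : _∼_ σ′ d (α d)
    merged = subst (λ y → _∼_ σ′ y (σ (α d))) (swap-right d (α d)) (σ′-swap (α d))
      ◅◅ ∼-sym σ′ (∼-cong (sym ∘ σ′≗σ″) (join σ-injective σd≁σαd))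
      ◅◅ ∼-sym σ′ (subst (λ y → _∼_ σ′ y (σ d)) (swap-left d (α d)) (σ′-swap d))

    coarser : _∼_ σ ⇒ _∼_ σ′
    coarser = generated λ { refl → ∼-sym σ′ (swap-absorb merged _) ◅◅ σ′-swap _ }

    contract : Genus0 σ′ α′
    contract = record
      { σ-injective = swap-injective d (α d) ∘ σ-injective
      ; α-injective = α-injective ∘ swap-injective d (α d)
      ; σ-classes   = proj₂ (cycles σ′)
      ; α-classes   = proj₂ (cycles α′)
      ; φ-classes   = classes-cong (∼-cong (sym ∘ φ′≗φ)) (∼-cong φ′≗φ) φ-classes
      ; classes     = classes-cong J⇒J′ J′⇒J classes
      -- The cycle of `d` under `α` splits while the two end vertices merge, so the sum of vertices
      -- and edges is unchanged.
      ; euler       = trans (cong (_+ faces) (begin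
          proj₁ (cycles σ′) + proj₁ (cycles α′)  ≡⟨ cong (proj₁ (cycles σ′) +_) edges′ ⟩
          proj₁ (cycles σ′) + suc edges          ≡⟨ ℕ.+-suc _ edges ⟩
          suc (proj₁ (cycles σ′)) + edges        ≡⟨ cong (_+ edges) vertices′ ⟨
          vertices + edges                       ∎)) euler
      }
      where
      open ≡-Reasoning
      edges′ : proj₁ (cycles α′) ≡ suc edges
      edges′ = split-classes α-injective (λ d≡αd → d≁αd (subst (_∼_ σ d) d≡αd ε))
        (∼-step α d) α-classes (proj₂ (cycles α′))
      vertices′ : vertices ≡ suc (proj₁ (cycles σ′))
      vertices′ = join-classes σ-injective σd≁σαd σ-classes
        (classes-cong (∼-cong σ′≗σ″) (∼-cong (sym ∘ σ′≗σ″)) (proj₂ (cycles σ′)))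
      J⇒J′ : EqClosure (Joint σ α) ⇒ EqClosure (Joint σ′ α′)
      J⇒J′ = generated λ
        { (inj₁ refl) → EqC.map inj₁ (coarser (∼-step σ _))
        ; (inj₂ refl) → joint-α _ ◅◅ swap-absorb (EqC.map inj₁ merged) _ }
      J′⇒J : EqClosure (Joint σ′ α′) ⇒ EqClosure (Joint σ α)
      J′⇒J = generated λ
        { (inj₁ refl) → joint-sym (swap-absorb (joint-α d) _) ◅◅ joint-σ _
        ; (inj₂ refl) → joint-α _ ◅◅ joint-sym (swap-absorb (joint-α d) _) }

  module _ {V : Set} (_≟ᵛ_ : DecidableEquality V) (tail : A → V) {σ α : A → A} (G : Genus0 σ α)
    (tail-σ : ∀ x → tail (σ x) ≡ tail x) (σ-transitive : ∀ {x y} → tail x ≡ tail y → _∼_ σ x y) where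

    private
      φ : A → A
      φ = σ ∘ α

      identify : V → V → V → V
      identify a b v with v ≟ᵛ b
      ... | yes _ = a
      ... | no _  = v

      identify-≡ : ∀ a b → identify a b b ≡ a
      identify-≡ a b with b ≟ᵛ b
      ... | yes _ = refl
      ... | no b≢b = contradiction refl b≢b

      identify-≢ : ∀ {a b v} → v ≢ b → identify a b v ≡ v
      identify-≢ {b = b} {v} v≢b with v ≟ᵛ b
      ... | yes v≡b = contradiction v≡b v≢b
      ... | no _ = refl

      swap-invariant : ∀ {B : Set} (g : A → B) {d e} → g d ≡ g e → ∀ x → g (swap d e x) ≡ g x
      swap-invariant g {d} {e} gd≡ge x with swapView d e x
      ... | at-left = trans (cong g (swap-left d e)) (sym gd≡ge)
      ... | at-right = trans (cong g (swap-right d e)) gd≡ge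
      ... | elsewhere x≢d x≢e = cong g (swap-other x≢d x≢e)

      sep : ∀ {x y} → tail x ≢ tail y → x ≢ y
      sep tx≢ty = tx≢ty ∘ cong tail

    -- Contracting both edges would turn p, r and q, t into corners of two vertices that
    -- alternate on a face.
    noncrossing-edges : ∀ d e {p r} i j → let q = iterate φ p i ; t = iterate φ r j in
      tail d ≢ tail (α d) → tail e ≢ tail (α e) →
      tail d ≢ tail e → tail d ≢ tail (α e) → tail (α d) ≢ tail e → tail (α d) ≢ tail (α e) →
      tail p ≡ tail d → tail r ≡ tail (α d) → tail q ≡ tail e → tail t ≡ tail (α e) →
      _∼_ φ p r →
      (∀ k → k < i → iterate φ p (suc k) ≢ p × iterate φ p (suc k) ≢ r) →
      (∀ k → k < j → iterate φ r (suc k) ≢ p × iterate φ r (suc k) ≢ r) → ⊥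
    noncrossing-edges d e {p} {r} i j a≢b c≢d a≢c a≢d b≢c b≢d p-a r-b q-c t-d p∼r avoid-p avoid-r =
      a≢c (begin
        tail d                    ≡⟨ identify-≢ a≢d ⟨
        identify (tail e) (tail (α e)) (tail d) ≡⟨ cong (identify (tail e) (tail (α e))) (trans (cong (identify (tail d) (tail (α d))) p-a) (identify-≢ a≢b)) ⟨
        g₂ p                      ≡⟨ ∼-invariant K₂.σ′ g₂ g₂-invariant p∼q ⟩
        g₂ (iterate φ p i)        ≡⟨ cong (identify (tail e) (tail (α e))) (trans (cong (identify (tail d) (tail (α d))) q-c) (identify-≢ (b≢c ∘ sym))) ⟩
        identify (tail e) (tail (α e)) (tail e) ≡⟨ identify-≢ c≢d ⟩
        tail e                    ∎)
      where
      open ≡-Reasoning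
      -- The tail maps after one and after two contractions. Being invariant under the contracted
      -- rotations, they show that the second edge is not yet a loop and that the two contracted
      -- vertices are distinct.
      g₁ g₂ : A → V
      g₁ = identify (tail d) (tail (α d)) ∘ tail
      g₂ = identify (tail e) (tail (α e)) ∘ g₁
      module K₁ = Contract G {d} (a≢b ∘ ∼-invariant σ tail tail-σ)
      α₁e≡αe : K₁.α′ e ≡ α e
      α₁e≡αe = swap-other (sep (a≢d ∘ sym)) (sep (b≢d ∘ sym))
      g₁-e : g₁ e ≡ tail e
      g₁-e = identify-≢ (b≢c ∘ sym)
      g₁-αe : g₁ (K₁.α′ e) ≡ tail (α e)
      g₁-αe = trans (cong g₁ α₁e≡αe) (identify-≢ (b≢d ∘ sym))
      g₁-invariant : ∀ x → g₁ (K₁.σ′ x) ≡ g₁ x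
      g₁-invariant x = trans (cong (identify _ _) (tail-σ _))
        (swap-invariant g₁ (trans (identify-≢ a≢b) (sym (identify-≡ _ _))) x)
      module K₂ = Contract K₁.contract {e}
        (λ e∼αe → c≢d (trans (sym g₁-e) (trans (∼-invariant K₁.σ′ g₁ g₁-invariant e∼αe) g₁-αe)))
      g₂-invariant : ∀ x → g₂ (K₂.σ′ x) ≡ g₂ x
      g₂-invariant x = trans (cong (identify _ _) (g₁-invariant _)) (swap-invariant g₂
        (trans (cong (identify _ _) g₁-e) (trans (identify-≢ c≢d) (sym (trans (cong (identify _ _) g₁-αe) (identify-≡ _ _))))) x)
      φ₂ : A → A
      φ₂ = K₂.σ′ ∘ K₂.α′
      φ₂≗φ : φ₂ ≗ φ
      φ₂≗φ x = trans (K₂.φ′≗φ x) (K₁.φ′≗φ x)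
      iterate-φ₂ : ∀ x k → iterate φ₂ x k ≡ iterate φ x k
      iterate-φ₂ x zero = refl
      iterate-φ₂ x (suc k) = trans (cong (λ y → iterate φ₂ y k) (φ₂≗φ x)) (iterate-φ₂ (φ x) k)
      same-tail : ∀ {x y} → tail x ≡ tail y → _∼_ K₂.σ′ x y
      same-tail = K₂.coarser ∘ K₁.coarser ∘ σ-transitive
      p≢r : p ≢ r
      p≢r = sep (λ eq → a≢b (trans (sym p-a) (trans eq r-b)))
      avoids : ∀ {x k} → (∀ l → l < k → iterate φ x (suc l) ≢ p × iterate φ x (suc l) ≢ r) →
        ∀ l → l < k → iterate φ₂ x (suc l) ≢ p × iterate φ₂ x (suc l) ≢ r
      avoids {x} avoid l l<k rewrite iterate-φ₂ x (suc l) = avoid l l<k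
      p∼q : _∼_ K₂.σ′ p (iterate φ p i)
      p∼q = subst (_∼_ K₂.σ′ p) (iterate-φ₂ p i)
        (noncrossing-orbits K₂.contract i j p≢r (∼-cong (sym ∘ φ₂≗φ) p∼r) (avoids avoid-p) (avoids avoid-r)
          (same-tail p-a ◅◅ K₂.coarser K₁.merged ◅◅ same-tail (sym r-b))
          (same-tail (trans (cong tail (iterate-φ₂ p i)) q-c)
            ◅◅ K₂.merged ◅◅ same-tail (trans (cong tail α₁e≡αe) (trans (sym t-d) (cong tail (sym (iterate-φ₂ r j)))))))

-- From rotation systems to positions on a line.

-- The common image `z` of `x` and `y` has the periods `i + 1` and `j + 1`. After
-- `j(i + 1) + i = i(j + 1) + j` steps from `z` one is therefore both at `x` and at `y`.
periodic-injective : {A : Set} (π : A → A) → (∀ x → ∃ λ i → iterate π (π x) i ≡ x) → Injective _≡_ _≡_ π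
periodic-injective π return {x} {y} πx≡πy with return x | return y
... | i , eq-x | j , eq-y = begin
  x                                     ≡⟨ eq-x ⟨
  iterate π z i                         ≡⟨ cong (λ w → iterate π w i) (multiple i j (cong π eq-x)) ⟨
  iterate π (iterate π z (j * suc i)) i ≡⟨ iterate-+ π z (j * suc i) i ⟨
  iterate π z (j * suc i + i)           ≡⟨ cong (iterate π z) (solve 2 (λ i j → j :* (con 1 :+ i) :+ i := i :* (con 1 :+ j) :+ j) refl i j) ⟩
  iterate π z (i * suc j + j)           ≡⟨ iterate-+ π z (i * suc j) j ⟩
  iterate π (iterate π z (i * suc j)) j ≡⟨ cong (λ w → iterate π w j) (multiple j i (trans (cong (λ w → π (iterate π w j)) πx≡πy) (trans (cong π eq-y) (sym πx≡πy)))) ⟩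
  iterate π z j                         ≡⟨ cong (λ w → iterate π w j) πx≡πy ⟩
  iterate π (π y) j                     ≡⟨ eq-y ⟩
  y                                     ∎
  where
  open ≡-Reasoning
  open +-*-Solver
  z = π x
  multiple : ∀ i k → π (iterate π z i) ≡ z → iterate π z (k * suc i) ≡ z
  multiple i zero _ = refl
  multiple i (suc k) eq = trans (iterate-+ π z (suc i) (k * suc i))
    (trans (cong (λ w → iterate π w (k * suc i)) (trans (iterate-suc π z i) eq)) (multiple i k eq))

-- All that the colouring arguments use of outerplanarity.
record Layout (G : Graph) : Set₁ where
  field
    Component   : Set
    _≟ᶜ_        : DecidableEquality Component
    component   : Vertex G → Component
    position    : Vertex G → ℕ
    injective   : ∀ {u v} → component u ≡ component v → position u ≡ position v → u ≡ v
    adjacent    : ∀ {u v} → Adj G u v → component u ≡ component v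
    noncrossing : ∀ {a b c d} → component a ≡ component c →
      position a < position c → position c < position b → position b < position d →
      Adj G a b → Adj G c d → ⊥

module _ {G : Graph} where
  open Graph G using (order; adj-sym; adj-irrefl; Connected)

  Adj-sym : ∀ {u v} → Adj G u v → Adj G v u
  Adj-sym {u} {v} = subst T (adj-sym u v)

  Adj-irrefl : ∀ {u v} → Adj G u v → u ≢ v
  Adj-irrefl {u} uv refl = subst T (adj-irrefl u) uv

  Connected-sym : ∀ {u v} → Connected u v → Connected v u
  Connected-sym = Star.reverse Adj-sym

  dart-≡ : {d e : Dart G} → tail d ≡ tail e → head d ≡ head e → d ≡ e
  dart-≡ {dart u v p} {dart _ _ q} refl refl = cong (dart u v) (T-irrelevant p q)

  flip-flip : ∀ (d : Dart G) → flip (flip d) ≡ d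
  flip-flip d = dart-≡ refl refl

  flip-injective : Injective _≡_ _≡_ (flip {G})
  flip-injective {d} {e} eq = trans (sym (flip-flip d)) (trans (cong flip eq) (flip-flip e))

  module _ (ρ : RotationSystem G) where
    open RotationSystem ρ

    -- A dart is coded by the class of its edge and by whether its tail is the smaller end. This
    -- code supplies the dart count 2E and the decidable equality of darts on which all cycle counts
    -- rest.
    dartClasses : ∀ {E} → HasClasses SameEdge E → HasClasses {Dart G} _≡_ (E * 2)
    dartClasses {E} edges/E = hasClasses code decode code-decode (cong code) code-injective
      where
      open HasClasses edges/E
      orientation : Dart G → Fin 2
      orientation d with tail d Fin.<? head d
      ... | yes _ = zero
      ... | no _  = suc zero
      orientation-flip : ∀ d → orientation (flip d) ≢ orientation d
      orientation-flip d with tail d Fin.<? head d | head d Fin.<? tail d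
      ... | yes t<h | yes h<t = contradiction h<t (ℕ.<-asym t<h)
      ... | yes _   | no _    = λ ()
      ... | no _    | yes _   = λ ()
      ... | no t≮h  | no h≮t  = contradiction
        (Fin.toℕ-injective (ℕ.≤-antisym (ℕ.≮⇒≥ h≮t) (ℕ.≮⇒≥ t≮h))) (Adj-irrefl (edge d))
      code : Dart G → Fin (E * 2)
      code d = combine (class d) (orientation d)
      other : ∀ {i j k : Fin 2} → i ≢ j → k ≢ j → i ≡ k
      other {zero} {zero} i≢j _ = contradiction refl i≢j
      other {zero} {suc zero} {zero} _ _ = refl
      other {zero} {suc zero} {suc zero} _ k≢j = contradiction refl k≢j
      other {suc zero} {suc zero} i≢j _ = contradiction refl i≢j
      other {suc zero} {zero} {suc zero} _ _ = refl
      other {suc zero} {zero} {zero} _ k≢j = contradiction refl k≢j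
      orient : Dart G → Fin 2 → Dart G
      orient d b with orientation d Fin.≟ b
      ... | yes _ = d
      ... | no _ = flip d
      code-orient : ∀ d b → code (orient d b) ≡ combine (class d) b
      code-orient d b with orientation d Fin.≟ b
      ... | yes eq = cong (combine (class d)) eq
      ... | no neq = cong₂ combine (complete (inj₂ (flip-flip d))) (other (orientation-flip d) (neq ∘ sym))
      decode : Fin (E * 2) → Dart G
      decode i = orient (rep (proj₁ (remQuot {E} 2 i))) (proj₂ (remQuot {E} 2 i))
      code-decode : ∀ i → code (decode i) ≡ i
      code-decode i = trans (code-orient _ _)
        (trans (cong (λ j → combine j _) (class-rep _)) (Fin.combine-remQuot {E} 2 i))
      code-injective : ∀ {d e} → code d ≡ code e → d ≡ e
      code-injective {d} {e} eq with Fin.combine-injective (class d) (orientation d) (class e) (orientation e) eq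
      ... | class≡ , orientation≡ with sound class≡
      ... | inj₁ d≡e = d≡e
      ... | inj₂ refl = contradiction (sym orientation≡) (orientation-flip d)

    next-return : ∀ d → ∃ λ i → iterate next (next d) i ≡ d
    next-return d = next-cyclic (next d) d (next-tail d)

    next-injective : Injective _≡_ _≡_ next
    next-injective = periodic-injective next next-return

    next-transitive : ∀ {d e} → tail d ≡ tail e → _∼_ next d e
    next-transitive {d} {e} t≡t with next-cyclic d e t≡t
    ... | i , refl = ∼-iterate next d i

    faceStep-injective : Injective _≡_ _≡_ faceStep
    faceStep-injective = flip-injective ∘ next-injective

    module Plane (planar : Planar) where
      private
        V E F C : ℕ
        V = proj₁ planar
        E = proj₁ (proj₂ planar)
        F = proj₁ (proj₂ (proj₂ planar))
        C = proj₁ (proj₂ (proj₂ (proj₂ planar)))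
        V-E-F-C = proj₂ (proj₂ (proj₂ (proj₂ planar)))
        darts : HasClasses {Dart G} _≡_ (E * 2)
        darts = dartClasses (proj₁ (proj₂ V-E-F-C))

      open Permutations darts
      open Euler darts

      components/C : HasClasses SameComponent C
      components/C = proj₁ (proj₂ (proj₂ (proj₂ V-E-F-C)))

      genus0 : Genus0 next flip
      genus0 = record
        { σ-injective = next-injective
        ; α-injective = flip-injective
        ; σ-classes   = classes-cong next-transitive (∼-invariant next tail next-tail) (proj₁ V-E-F-C)
        ; α-classes   = classes-cong
            (λ { (inj₁ refl) → ε ; (inj₂ refl) → ∼-step flip _ })
            (E.sound ∘ ∼-invariant flip E.class (λ d → E.complete (inj₂ (flip-flip d))))
            (proj₁ (proj₂ V-E-F-C))
        ; φ-classes   = classes-cong (λ { (i , refl) → ∼-iterate faceStep _ i })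
            (orbit faceStep-injective) (proj₁ (proj₂ (proj₂ V-E-F-C)))
        ; classes     = classes-cong (λ {d} {e} → connected⇒joint d e) joint⇒connected components/C
        ; euler       = begin
            V + E + F         ≡⟨ solve 3 (λ v e f → v :+ e :+ f := v :+ f :+ e) refl V E F ⟩
            V + F + E         ≡⟨ cong (_+ E) (proj₂ (proj₂ (proj₂ (proj₂ V-E-F-C)))) ⟩
            E + 2 * C + E     ≡⟨ solve 2 (λ e c → e :+ con 2 :* c :+ e := e :* con 2 :+ con 2 :* c) refl E C ⟩
            E * 2 + 2 * C     ∎
        }
        where
        open ≡-Reasoning
        open +-*-Solver
        module E = HasClasses (proj₁ (proj₂ V-E-F-C))
        connected⇒joint : ∀ d e → Connected (tail d) (tail e) → EqClosure (Joint next flip) d e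
        connected⇒joint d e d⇝e = walk d refl d⇝e
          where
          walk : ∀ {u} d → tail d ≡ u → Connected u (tail e) → EqClosure (Joint next flip) d e
          walk d refl ε = EqC.map inj₁ (next-transitive refl)
          walk d refl (uv ◅ v⇝e) = EqC.map inj₁ (next-transitive {d} {dart _ _ uv} refl)
            ◅◅ joint-α _ ◅◅ walk (flip (dart _ _ uv)) refl v⇝e
        joint⇒connected : EqClosure (Joint next flip) ⇒ SameComponent
        joint⇒connected = EqC.fold
          record { refl = ε ; sym = Connected-sym ; trans = _◅◅_ }
          λ { {d} (inj₁ refl) → subst (Connected (tail d)) (sym (next-tail d)) ε
            ; {d} (inj₂ refl) → edge d ◅ ε }

      module Walk (o : Dart G) where
        visit : ℕ → Vertex G
        visit i = tail (iterate faceStep o i)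

        First : ℕ → Set
        First i = ∀ j → j < i → visit j ≢ visit i

        -- If the darts at times `i` and `j` agreed, the walk would repeat from there, and the
        -- vertex of time `l` would have been visited already at time `i + (l ∸ j)`.
        distinct : ∀ {i j l} → First l → i < j → j ≤ l → iterate faceStep o j ≢ iterate faceStep o i
        distinct {i} {j} {l} first i<j j≤l eq = first (i + (l ∸ j)) earlier (cong tail (begin
          iterate faceStep o (i + (l ∸ j))                      ≡⟨ iterate-+ faceStep o i (l ∸ j) ⟩
          iterate faceStep (iterate faceStep o i) (l ∸ j)       ≡⟨ cong (λ d → iterate faceStep d (l ∸ j)) eq ⟨
          iterate faceStep (iterate faceStep o j) (l ∸ j)       ≡⟨ iterate-+ faceStep o j (l ∸ j) ⟨
          iterate faceStep o (j + (l ∸ j))                      ≡⟨ cong (iterate faceStep o) (ℕ.m+[n∸m]≡n j≤l) ⟩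
          iterate faceStep o l                                  ∎))
          where
          open ≡-Reasoning
          earlier : i + (l ∸ j) < l
          earlier = subst (i + (l ∸ j) <_) (ℕ.m+[n∸m]≡n j≤l) (ℕ.+-monoˡ-< (l ∸ j) i<j)

        -- The darts at times `i` and `k` are the corners `p` and `r`, those at `j` and `l` are `q`
        -- and `t`. First visits make the four vertices distinct and, through `distinct`, keep the
        -- two pieces of the walk away from `p` and `r`.
        walk-noncrossing : ∀ {i j k l} → First j → First k → First l → i < j → j < k → k < l →
          Adj G (visit i) (visit k) → Adj G (visit j) (visit l) → ⊥
        walk-noncrossing {i} {j} {k} {l} first-j first-k first-l i<j j<k k<l ik jl =
          noncrossing-edges Fin._≟_ tail genus0 next-tail next-transitive
            (dart _ _ ik) (dart _ _ jl) (j ∸ i) (l ∸ k)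
            (first-k i i<k) (first-l j j<l) (first-j i i<j) (first-l i i<l)
            (first-k j j<k ∘ sym) (first-l k k<l)
            refl refl (cong tail (shift i<j)) (cong tail (shift k<l))
            (subst (_∼_ faceStep _) (shift i<k) (∼-iterate faceStep _ (k ∸ i)))
            (λ m m<j∸i → apart i<j m<j∸i (ℕ.<⇒≤ j<l) (inj₁ ℕ.≤-refl) , apart i<j m<j∸i (ℕ.<⇒≤ j<l) (inj₂ (j<k , ℕ.<⇒≤ k<l)))
            (λ m m<l∸k → apart k<l m<l∸k ℕ.≤-refl (inj₁ (ℕ.<⇒≤ i<k)) , apart k<l m<l∸k ℕ.≤-refl (inj₁ ℕ.≤-refl))
          where
          i<k = ℕ.<-trans i<j j<k
          j<l = ℕ.<-trans j<k k<l
          i<l = ℕ.<-trans i<j j<l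
          shift : ∀ {s t} → s < t → iterate faceStep (iterate faceStep o s) (t ∸ s) ≡ iterate faceStep o t
          shift {s} {t} s<t = trans (sym (iterate-+ faceStep o s (t ∸ s))) (cong (iterate faceStep o) (ℕ.m+[n∸m]≡n (ℕ.<⇒≤ s<t)))
          apart : ∀ {s t m x} → s < t → m < t ∸ s → t ≤ l → x ≤ s ⊎ t < x × x ≤ l →
            iterate faceStep (iterate faceStep o s) (suc m) ≢ iterate faceStep o x
          apart {s} {t} {m} s<t m<t∸s t≤l x-side eq with trans (iterate-+ faceStep o s (suc m)) eq
            | subst (s + suc m ≤_) (ℕ.m+[n∸m]≡n (ℕ.<⇒≤ s<t)) (ℕ.+-monoʳ-≤ s m<t∸s)
          apart {s} {t} {m} _ _ t≤l (inj₁ x≤s) _ | eq | s+m<t =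
            distinct first-l (ℕ.≤-<-trans x≤s (ℕ.m<m+n s (s≤s z≤n))) (ℕ.≤-trans s+m<t t≤l) eq
          apart _ _ _ (inj₂ (t<x , x≤l)) _ | eq | s+m<t =
            distinct first-l (ℕ.≤-<-trans s+m<t t<x) x≤l (sym eq)

      module _ (outer : AllVerticesOnOuterFace) where
        private
          module C = HasClasses components/C
          module W k = Walk (proj₁ (outer (C.rep k)))

        record Located (v : Vertex G) (k : Fin C) (i : ℕ) : Set where
          field
            visited  : W.visit k i ≡ v
            first    : ∀ j → j < i → W.visit k j ≢ v
            in-class : ∀ d → tail d ≡ v → C.class d ≡ k
        open Located

        -- An isolated vertex carries no dart and so belongs to none of the `C` counted components;
        -- `layout` makes it a component of its own, at position 0.
        place : ∀ v → (∀ u → ¬ Adj G v u) ⊎ ∃₂ (Located v)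
        place v with Fin.any? (λ u → T? (Graph.adjacent G v u))
        ... | no isolated = inj₁ λ u vu → isolated (u , vu)
        ... | yes (u , vu) with proj₂ (outer (C.rep (C.class (dart v u vu)))) v (C.rep-class (dart v u vu))
        ...   | _ , (i , refl) , tail≡v with least (λ i → W.visit (C.class (dart v u vu)) i Fin.≟ v) i tail≡v
        ...     | j , visited , first = inj₂ (C.class (dart v u vu) , j , record
          { visited  = visited
          ; first    = first
          ; in-class = λ { d refl → C.complete ε }
          })

        located-noncrossing : ∀ {a b c d x i j k l} →
          Located a x i → Located c x j → Located b x k → Located d x l →
          i < j → j < k → k < l → Adj G a b → Adj G c d → ⊥
        located-noncrossing a c b d i<j j<k k<l ab cd with visited a | visited c | visited b | visited d
        ... | refl | refl | refl | refl =
          W.walk-noncrossing _ (first c) (first b) (first d) i<j j<k k<l ab cd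

        layout : Layout G
        layout = record
          { Component   = Fin C ⊎ Vertex G
          ; _≟ᶜ_        = ≡-dec Fin._≟_ Fin._≟_
          ; component   = component ∘ place
          ; position    = position ∘ place
          ; injective   = λ {u} {v} → injective (place u) (place v)
          ; adjacent    = λ {u} {v} → adjacent (place u) (place v)
          ; noncrossing = λ {a} {b} {c} {d} → noncrossing (place a) (place b) (place c) (place d)
          }
          where
          Place : Vertex G → Set
          Place v = (∀ u → ¬ Adj G v u) ⊎ ∃₂ (Located v)
          component : ∀ {v} → Place v → Fin C ⊎ Vertex G
          component {v} (inj₁ _)       = inj₂ v
          component     (inj₂ (k , _)) = inj₁ k
          position : ∀ {v} → Place v → ℕ
          position (inj₁ _)           = 0
          position (inj₂ (_ , i , _)) = i
          injective : ∀ {u v} (p : Place u) (q : Place v) → component p ≡ component q → position p ≡ position q → u ≡ v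
          injective (inj₁ _) (inj₁ _) refl _ = refl
          injective (inj₂ (_ , _ , u)) (inj₂ (_ , _ , v)) refl refl = trans (sym (visited u)) (visited v)
          adjacent : ∀ {u v} (p : Place u) (q : Place v) → Adj G u v → component p ≡ component q
          adjacent (inj₁ isolated) _ uv = contradiction uv (isolated _)
          adjacent (inj₂ _) (inj₁ isolated) uv = contradiction (Adj-sym uv) (isolated _)
          adjacent (inj₂ (_ , _ , u)) (inj₂ (_ , _ , v)) uv = cong inj₁
            (trans (sym (in-class u (dart _ _ uv) refl))
              (trans (C.complete (uv ◅ ε)) (in-class v (flip (dart _ _ uv)) refl)))
          noncrossing : ∀ {a b c d} (p : Place a) (q : Place b) (r : Place c) (s : Place d) → component p ≡ component r →
            position p < position r → position r < position q → position q < position s →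
            Adj G a b → Adj G c d → ⊥
          noncrossing (inj₁ isolated) _ _ _ _ _ _ _ ab _ = isolated _ ab
          noncrossing (inj₂ _) (inj₁ isolated) _ _ _ _ _ _ ab _ = isolated _ (Adj-sym ab)
          noncrossing (inj₂ _) (inj₂ _) (inj₂ _) (inj₁ isolated) _ _ _ _ _ cd = isolated _ (Adj-sym cd)
          noncrossing p@(inj₂ (_ , _ , a)) q@(inj₂ (_ , _ , b)) r@(inj₂ (_ , _ , c)) s@(inj₂ (_ , _ , d))
            refl i<j j<k k<l ab cd with adjacent p q ab | adjacent r s cd
          ... | refl | refl = located-noncrossing a c b d i<j j<k k<l ab cd

outerplanar-layout : ∀ {G} → Outerplanar G → Layout G
outerplanar-layout (ρ , planar , outer) = Plane.layout ρ planar outer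

-- Counting how often a bound on colours is attained.

-- No colour on S exceeds m, and n vertices of S have colour m; no information is kept for n ≥ 2.
Load : {A : Set} {k : ℕ} → (A → Fin k) → Pred A 0ℓ → Fin k → ℕ → Set
Load c S m 0 = ∀ y → S y → c y Fin.< m
Load c S m 1 = ∃ λ z → S z × c z ≡ m × (∀ y → S y → y ≢ z → c y Fin.< m)
Load c S m (suc (suc _)) = ⊤

module _ {A : Set} {k : ℕ} where
  load-cong : ∀ {c c′ : A → Fin k} {S S′ : Pred A 0ℓ} {m} n → (∀ {y} → S y → S′ y) → (∀ {y} → S′ y → S y) →
    (∀ {y} → S y → c y ≡ c′ y) → Load c S m n → Load c′ S′ m n
  load-cong 0 _ S′⊆S c≡c′ below y y∈ = subst (Fin._< _) (c≡c′ (S′⊆S y∈)) (below y (S′⊆S y∈))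
  load-cong 1 S⊆S′ S′⊆S c≡c′ (z , z∈ , cz≡m , below) = z , S⊆S′ z∈ , trans (sym (c≡c′ z∈)) cz≡m ,
    λ y y∈ y≢z → subst (Fin._< _) (c≡c′ (S′⊆S y∈)) (below y (S′⊆S y∈) y≢z)
  load-cong (suc (suc _)) _ _ _ _ = tt

  load-∪ : ∀ {c : A → Fin k} {S S′ : Pred A 0ℓ} {m} n n′ →
    Load c S m n → Load c S′ m n′ → Load c (λ y → S y ⊎ S′ y) m (n + n′)
  load-∪ 0 0 below below′ y (inj₁ y∈) = below y y∈
  load-∪ 0 0 below below′ y (inj₂ y∈) = below′ y y∈
  load-∪ 0 1 below (z , z∈ , cz≡m , below′) = z , inj₂ z∈ , cz≡m ,
    λ { y (inj₁ y∈) _ → below y y∈ ; y (inj₂ y∈) → below′ y y∈ }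
  load-∪ 0 (suc (suc _)) _ _ = tt
  load-∪ 1 0 (z , z∈ , cz≡m , below) below′ = z , inj₁ z∈ , cz≡m ,
    λ { y (inj₁ y∈) → below y y∈ ; y (inj₂ y∈) _ → below′ y y∈ }
  load-∪ 1 (suc _) _ _ = tt
  load-∪ (suc (suc _)) _ _ _ = tt

-- A colour above the bound gets load 2, the value at which `Load` says nothing. Overshooting the
-- bound and attaining it twice are thus rejected by the same tests.
load : ∀ {k} → Fin k → Fin k → ℕ
load zero    zero    = 1
load zero    (suc _) = 0
load (suc _) zero    = 2
load (suc x) (suc m) = load x m

loadIf : ∀ {k} → Bool → Fin k → Fin k → ℕ
loadIf true  x m = load x m
loadIf false _ _ = 0

data LoadView {k} (x m : Fin k) : ℕ → Set where
  under : x Fin.< m → LoadView x m 0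
  meets : x ≡ m → LoadView x m 1
  exceeds : LoadView x m 2

loadView : ∀ {k} (x m : Fin k) → LoadView x m (load x m)
loadView zero zero = meets refl
loadView zero (suc m) = under (s≤s z≤n)
loadView (suc x) zero = exceeds
loadView (suc x) (suc m) with load x m | loadView x m
... | _ | under x<m = under (s≤s x<m)
... | _ | meets x≡m = meets (cong suc x≡m)
... | _ | exceeds     = exceeds

load-single : ∀ {A : Set} {k} (c : A → Fin k) b z m → Load c (λ y → T b × y ≡ z) m (loadIf b (c z) m)
load-single c false z m = λ _ ()
load-single c true z m with load (c z) m | loadView (c z) m
... | _ | under cz<m = λ { _ (_ , refl) → cz<m }
... | _ | meets cz≡m = z , (tt , refl) , cz≡m , λ { y (_ , y≡z) y≢z → contradiction y≡z y≢z }
... | _ | exceeds = tt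

distinct? : ∀ {k} → Fin k → Fin k → Bool
distinct? zero zero = false
distinct? (suc x) (suc y) = distinct? x y
distinct? _ _ = true

distinct?-sound : ∀ {k} (x y : Fin k) → T (distinct? x y) → x ≢ y
distinct?-sound (suc x) (suc x) d refl = distinct?-sound x x d refl

-- States and types of intervals.

-- The state of an end of an interval of vertices: its colour, an upper bound for the colours
-- of its neighbourhood in the whole graph, and the number of its neighbours inside the
-- interval that attain the bound.
record State (k : ℕ) : Set where
  constructor state
  field
    colour top : Fin k
    hits       : Fin 2

-- To be read as a set of pairs of end states, each of which some colouring of the interval attains
-- at both ends simultaneously.
Type : ℕ → Set
Type k = State k → State k → Bool

module _ {k : ℕ} where
  private
    Table : Set → Set
    Table A = Vec (Vec (Vec A 2) k) k

    tabulateˢ : {A : Set} → (State k → A) → Table A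
    tabulateˢ f = tabulate λ x → tabulate λ m → tabulate λ n → f (state x m n)

    lookupˢ : {A : Set} → Table A → State k → A
    lookupˢ t (state x m n) = lookup (lookup (lookup t x) m) n

    lookup∘tabulateˢ : {A : Set} (f : State k → A) → ∀ s → lookupˢ (tabulateˢ f) s ≡ f s
    lookup∘tabulateˢ f (state x m n) = begin
      lookup (lookup (lookup (tabulateˢ f) x) m) n ≡⟨ cong (λ t → lookup (lookup t m) n) (Vec.lookup∘tabulate _ x) ⟩
      lookup (lookup (tabulate λ m → tabulate λ n → f (state x m n)) m) n ≡⟨ cong (λ t → lookup t n) (Vec.lookup∘tabulate _ m) ⟩
      lookup (tabulate λ n → f (state x m n)) n ≡⟨ Vec.lookup∘tabulate (λ n → f (state x m n)) n ⟩
      f (state x m n) ∎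
      where open ≡-Reasoning

    lookup² : Table (Table Bool) → Type k
    lookup² t s s′ = lookupˢ (lookupˢ t s) s′

  -- Extensionally the identity; the table is shared by all evaluations of the result.
  memo : Type k → Type k
  memo f = lookup² (tabulateˢ λ s → tabulateˢ λ s′ → f s s′)

  memo-≡ : ∀ f s s′ → memo f s s′ ≡ f s s′
  memo-≡ f s s′ = trans (cong (λ t → lookupˢ t s′) (lookup∘tabulateˢ (λ s → tabulateˢ (f s)) s)) (lookup∘tabulateˢ (f s) s′)

infixr 5 _implies_
_implies_ : Bool → Bool → Bool
true  implies b = b
false implies _ = true

implies-T : ∀ {a b} → T (a implies b) → T a → T b
implies-T {true} b _ = b

∧-T : ∀ {a b} → T (a ∧ b) → T a × T b
∧-T = Equivalence.to T-∧

∨-T : ∀ {a b} → T (a ∨ b) → T a ⊎ T b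
∨-T = Equivalence.to T-∨

-- Subtraction in continuation form: the middle vertex contributes `l` of the `n` hits of an end,
-- the smaller interval has to supply the rest, and a negative rest fails. `shared` likewise
-- distributes over both intervals what the middle vertex lacks to a total of one.
remaining : ℕ → Fin 2 → (Fin 2 → Bool) → Bool
remaining 0 n  p = p n
remaining 1 1F p = p 0F
remaining _ _  _ = false

remaining-sound : ∀ l n {p} → T (remaining l n p) → ∃ λ n′ → T (p n′) × toℕ n′ + l ≡ toℕ n
remaining-sound 0 n p = n , p , ℕ.+-identityʳ (toℕ n)
remaining-sound 1 1F p = 0F , p , refl

shared : ℕ → (Fin 2 → Fin 2 → Bool) → Bool
shared 0 p = p 0F 1F ∨ p 1F 0F
shared 1 p = p 0F 0F
shared _ _ = false

shared-sound : ∀ l {p} → T (shared l p) → ∃₂ λ a b → T (p a b) × l + (toℕ a + toℕ b) ≡ 1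
shared-sound 0 p with ∨-T p
... | inj₁ p = 0F , 1F , p , refl
... | inj₂ p = 1F , 0F , p , refl
shared-sound 1 p = 0F , 0F , p , refl

-- Kinds lists the pairs (colour , top) to which the search is restricted.
module Types {k : ℕ} (closed : Bool) (kinds : List (Fin k × Fin k)) where

  kind : State k → Fin k × Fin k
  kind (state x m _) = x , m

  -- The middle vertex has all its neighbours in the combined interval, so it is settled here:
  -- `total` says that its bound is attained exactly once. The two ends only pass on their counts.
  record Composite (uv vw : Bool) (L R : Type k) (s s′ : State k) : Set where
    open State s renaming (colour to x; top to m; hits to n)
    open State s′ renaming (colour to x′; top to m′; hits to n′)
    field
      {y t}     : Fin k
      {nₗ nᵣ a b} : Fin 2
      known     : (y , t) ∈ kinds
      y≢x       : T uv → y ≢ x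
      y≢x′      : T vw → y ≢ x′
      left-hits : toℕ nₗ + loadIf uv y m ≡ toℕ n
      right-hits : toℕ nᵣ + loadIf vw y m′ ≡ toℕ n′
      total     : loadIf closed y t + (loadIf uv x t + loadIf vw x′ t) + (toℕ a + toℕ b) ≡ 1
      left      : T (L (state x m nₗ) (state y t a))
      right     : T (R (state y t b) (state x′ m′ nᵣ))

  opaque
    -- The states of the ends u and w of an interval that is made of the intervals from u to v
    -- and from v to w; the flags tell whether v is adjacent to u and to w.
    compose : Bool → Bool → Type k → Type k → Type k
    compose uv vw L R (state x m n) (state x′ m′ n′) =
      any (λ (y , t) → (uv implies distinct? y x) ∧ (vw implies distinct? y x′) ∧
        remaining (loadIf uv y m) n λ nₗ → remaining (loadIf vw y m′) n′ λ nᵣ →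
        shared (loadIf closed y t + (loadIf uv x t + loadIf vw x′ t)) λ a b →
        L (state x m nₗ) (state y t a) ∧ R (state y t b) (state x′ m′ nᵣ)) kinds

    composite : ∀ uv vw L R s s′ → T (compose uv vw L R s s′) → Composite uv vw L R s s′
    composite uv vw L R (state x m n) (state x′ m′ n′) c with find (any⁻ _ kinds c)
    ... | (y , t) , known , p with ∧-T p
    ... | y≢x , p with ∧-T p
    ... | y≢x′ , p with remaining-sound (loadIf uv y m) n p
    ... | nₗ , p , left-hits with remaining-sound (loadIf vw y m′) n′ p
    ... | nᵣ , p , right-hits with shared-sound (loadIf closed y t + (loadIf uv x t + loadIf vw x′ t)) p
    ... | a , b , p , total = record
      { known      = known
      ; y≢x        = distinct?-sound y x ∘ implies-T y≢x
      ; y≢x′       = distinct?-sound y x′ ∘ implies-T y≢x′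
      ; left-hits  = left-hits
      ; right-hits = right-hits
      ; total      = total
      ; left       = proj₁ (∧-T p)
      ; right      = proj₂ (∧-T p)
      }

  everyState someState : (State k → Bool) → Bool
  everyState p = all (λ (x , m) → p (state x m 0F) ∧ p (state x m 1F)) kinds
  someState  p = any (λ (x , m) → p (state x m 0F) ∨ p (state x m 1F)) kinds

  everyState-sound : ∀ p → T (everyState p) → ∀ s → kind s ∈ kinds → T (p s)
  everyState-sound p ps (state x m 0F) s∈ = proj₁ (∧-T (All.lookup (all⁺ _ kinds ps) s∈))
  everyState-sound p ps (state x m 1F) s∈ = proj₂ (∧-T (All.lookup (all⁺ _ kinds ps) s∈))

  someState-sound : ∀ p → T (someState p) → ∃ λ s → kind s ∈ kinds × T (p s)
  someState-sound p some with find (any⁻ _ kinds some)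
  ... | (x , m) , s∈ , ps with ∨-T ps
  ... | inj₁ ps = state x m 0F , s∈ , ps
  ... | inj₂ ps = state x m 1F , s∈ , ps

  opaque
    _⊑_ : Type k → Type k → Bool
    U ⊑ V = everyState λ s → everyState λ s′ → U s s′ implies V s s′

    ⊑-sound : ∀ U V → T (U ⊑ V) → ∀ s s′ → kind s ∈ kinds → kind s′ ∈ kinds → T (U s s′) → T (V s s′)
    ⊑-sound U V U⊑V s s′ s∈ s′∈ = implies-T (everyState-sound (λ s′ → U s s′ implies V s s′)
      (everyState-sound (λ s → everyState λ s′ → U s s′ implies V s s′) U⊑V s s∈) s′ s′∈)

  completes : State k → Bool
  completes s = loadIf closed (State.colour s) (State.top s) + toℕ (State.hits s) ≡ᵇ 1

  opaque
    -- One pair is enough, since it serves for a left end that is the first vertex of its component: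
    -- this vertex has no neighbours elsewhere, so its bound must be attained already.
    rooted : Type k → Bool
    rooted U = someState λ s → completes s ∧ someState (U s)

    rooted-sound : ∀ U → T (rooted U) → ∃₂ λ s s′ → kind s ∈ kinds × kind s′ ∈ kinds × T (completes s) × T (U s s′)
    rooted-sound U p with someState-sound (λ s → completes s ∧ someState (U s)) p
    ... | s , s∈ , p with ∧-T p
    ... | done , p with someState-sound (U s) p
    ... | s′ , s′∈ , Uss′ = s , s′ , s∈ , s′∈ , done , Uss′

  module Family (𝓑 𝓕 : List (Type k)) where
    covered : List (Type k) → Bool → Bool → Type k → Type k → Bool
    covered 𝓒 uv vw L R = any (_⊑ compose uv vw L R) 𝓒

    -- `attached` covers a splitting vertex that is the last inner neighbour of the left end,
    -- adjacent to the right end or not. `detached` covers a left end without inner neighbours; the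
    -- splitting vertex is then the first inner neighbour of the right end, and the left part again
    -- has a free left end, whence `𝓑`.
    attached detached : Type k → Type k → Bool
    attached L R = covered 𝓕 true true L R ∧ (covered 𝓕 true false L R ∧ rooted (compose true false L R))
    detached L R = covered 𝓑 false true L R

    closedUnderComposition : Bool
    closedUnderComposition = all (λ L → all (attached L) 𝓕) 𝓕 ∧ all (λ L → all (detached L) 𝓕) 𝓑

-- Graphs on a line without crossing edges, and their separating vertices.

module _ {P : Pred ℕ 0ℓ} (P? : Decidable P) where
  last : ∀ w → (∃ λ y → y < w × P y × (∀ {z} → y < z → z < w → ¬ P z)) ⊎ (∀ {z} → z < w → ¬ P z)
  last zero = inj₂ λ ()
  last (suc w) with P? w
  ... | yes Pw = inj₁ (w , ℕ.≤-refl , Pw , λ w<z z<1+w → contradiction w<z (ℕ.≤⇒≯ (ℕ.s≤s⁻¹ z<1+w)))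
  ... | no ¬Pw with last w
  ... | inj₁ (y , y<w , Py , beyond) = inj₁ (y , ℕ.m<n⇒m<1+n y<w , Py , λ {z} y<z z<1+w →
          [ beyond y<z , (λ { refl → ¬Pw }) ]′ (ℕ.m≤n⇒m<n∨m≡n (ℕ.s≤s⁻¹ z<1+w)))
  ... | inj₂ none = inj₂ λ z<1+w → [ none , (λ { refl → ¬Pw }) ]′ (ℕ.m≤n⇒m<n∨m≡n (ℕ.s≤s⁻¹ z<1+w))

  first : ∀ w → (∃ λ y → y < w × P y × (∀ {z} → z < y → ¬ P z)) ⊎ (∀ {z} → z < w → ¬ P z)
  first zero = inj₂ λ ()
  first (suc w) with first w
  ... | inj₁ (y , y<w , Py , before) = inj₁ (y , ℕ.m<n⇒m<1+n y<w , Py , before)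
  ... | inj₂ none with P? w
  ... | yes Pw = inj₁ (w , ℕ.≤-refl , Pw , none)
  ... | no ¬Pw = inj₂ λ z<1+w → [ none , (λ { refl → ¬Pw }) ]′ (ℕ.m≤n⇒m<n∨m≡n (ℕ.s≤s⁻¹ z<1+w))

-- A one-page book embedding: vertices on a line, edges as pairwise noncrossing arcs on one side of
-- it.
record LinearGraph : Set₁ where
  field
    E             : Rel ℕ 0ℓ
    E?            : Decidable₂ E
    E-sym         : Symmetric E
    E-irrefl      : ∀ {x} → ¬ E x x
    E-noncrossing : ∀ {a b c d} → a < c → c < b → b < d → E a b → E c d → ⊥

  Between : ℕ → ℕ → ℕ → Set
  Between u w x = u < x × x < w

  Closed : ℕ → ℕ → Set
  Closed u w = ∀ {x y} → Between u w x → E x y → u ≤ y × y ≤ w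

  -- The edge between the two ends is exempt: it passes over every inner vertex, and no interval
  -- accounts for the edge joining its own ends.
  Separates : ℕ → ℕ → ℕ → Set
  Separates u v w = ∀ {y z} → u ≤ y → y < v → v < z → z ≤ w → E y z → y ≡ u × z ≡ w

  closed-left : ∀ {u v w} → v < w → Closed u w → Separates u v w → Closed u v
  closed-left {u} {v} v<w closed sep {x} {y} (u<x , x<v) xy with closed (u<x , ℕ.<-trans x<v v<w) xy
  ... | u≤y , y≤w with y ℕ.≤? v
  ... | yes y≤v = u≤y , y≤v
  ... | no y≰v = contradiction (sym (proj₁ (sep (ℕ.<⇒≤ u<x) x<v (ℕ.≰⇒> y≰v) y≤w xy))) (ℕ.<⇒≢ u<x)

  closed-right : ∀ {u v w} → u < v → Closed u w → Separates u v w → Closed v w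
  closed-right {u} {v} u<v closed sep {x} {y} (v<x , x<w) xy with closed (ℕ.<-trans u<v v<x , x<w) xy
  ... | u≤y , y≤w with v ℕ.≤? y
  ... | yes v≤y = v≤y , y≤w
  ... | no v≰y = contradiction (proj₂ (sep u≤y (ℕ.≰⇒> v≰y) v<x (ℕ.<⇒≤ x<w) (E-sym xy))) (ℕ.<⇒≢ x<w)

  -- An edge over `v` that starts inside crosses the edge from `u` to `v`; one that starts at `u`
  -- ends beyond the last inner neighbour, hence at `w`.
  farthest-separates : ∀ {u v w} → u < v → E u v → (∀ {z} → v < z → z < w → ¬ E u z) → Separates u v w
  farthest-separates {w = w} u<v uv far {y} {z} u≤y y<v v<z z≤w yz with ℕ.m≤n⇒m<n∨m≡n u≤y | ℕ.m≤n⇒m<n∨m≡n z≤w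
  ... | inj₁ u<y  | _         = contradiction yz (E-noncrossing u<y y<v v<z uv)
  ... | inj₂ refl | inj₁ z<w  = contradiction yz (far v<z z<w)
  ... | inj₂ refl | inj₂ refl = refl , refl

  -- The mirrored argument with the edge from `v` to `w`. Edges over `v` from `u` to an inner vertex
  -- would escape it and are excluded by the last hypothesis.
  nearest-separates : ∀ {u v w} → v < w → E v w → (∀ {z} → u < z → z < v → ¬ E z w) →
    (∀ {z} → u < z → z < w → ¬ E u z) → Separates u v w
  nearest-separates {u} {v} {w} v<w vw near free {y} {z} u≤y y<v v<z z≤w yz
    with ℕ.m≤n⇒m<n∨m≡n u≤y | ℕ.m≤n⇒m<n∨m≡n z≤w
  ... | inj₁ u<y  | inj₁ z<w  = contradiction vw (E-noncrossing y<v v<z z<w yz)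
  ... | inj₁ u<y  | inj₂ refl = contradiction yz (near u<y y<v)
  ... | inj₂ refl | inj₁ z<w  = contradiction yz (free (ℕ.<-trans y<v v<z) z<w)
  ... | inj₂ refl | inj₂ refl = refl , refl

-- Realising types by gluing colourings.

does⁺ : ∀ {A : Set} (a? : Dec A) → A → T (does a?)
does⁺ (yes _) _ = tt
does⁺ (no ¬a) a = contradiction a ¬a

does⁻ : ∀ {A : Set} (a? : Dec A) → T (does a?) → A
does⁻ (yes a) _ = a

module Intervals {k : ℕ} (closed : Bool) (kinds : List (Fin k × Fin k)) (L : LinearGraph) where
  open LinearGraph L
  open Types closed kinds
  open State

  Sees : ℕ → Pred ℕ 0ℓ
  Sees x y = E x y ⊎ T closed × y ≡ x

  -- The first alternative arises for open neighbourhoods at places without edges, which see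
  -- nothing. It is ruled out for vertices with a nonempty neighbourhood when the colouring is
  -- carried back to the graph.
  Good : (ℕ → Fin k) → ℕ → Set
  Good c x = (∀ {y} → E x y → c x ≢ c y) × ((∀ {y} → ¬ Sees x y) ⊎ ∃ λ m → Load c (Sees x) m 1)

  good-cong : ∀ {c c′ x} → (∀ {y} → y ≡ x ⊎ E x y → c y ≡ c′ y) → Good c x → Good c′ x
  good-cong c≡c′ (proper , satisfied) =
    (λ xy eq → proper xy (trans (c≡c′ (inj₁ refl)) (trans eq (sym (c≡c′ (inj₂ xy)))))) ,
    [ inj₁ , (λ (m , l) → inj₂ (m , load-cong 1 id id
      (λ { (inj₁ xy) → c≡c′ (inj₂ xy) ; (inj₂ (_ , y≡x)) → c≡c′ (inj₁ y≡x) }) l)) ]′ satisfied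

  -- The other end of the interval is left out even if it is adjacent to `v`; the flags of `compose`
  -- count that edge when the interval becomes a part of a larger one.
  Inner : ℕ → ℕ → ℕ → Pred ℕ 0ℓ
  Inner u w v y = Between u w y × E v y

  record Realises (c : ℕ → Fin k) (u w : ℕ) (s s′ : State k) : Set where
    field
      left       : c u ≡ colour s
      right      : c w ≡ colour s′
      good       : ∀ {x} → Between u w x → Good c x
      left-load  : Load c (Inner u w u) (top s) (toℕ (hits s))
      right-load : Load c (Inner u w w) (top s′) (toℕ (hits s′))

  Realisable : ℕ → ℕ → Type k → Set
  Realisable u w U = ∀ s s′ → kind s ∈ kinds → kind s′ ∈ kinds → T (U s s′) → ∃ λ c → Realises c u w s s′

  realisable-⊑ : ∀ {u w U V} → T (U ⊑ V) → Realisable u w V → Realisable u w U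
  realisable-⊑ {U = U} {V} U⊑V V-real s s′ s∈ s′∈ Uss′ = V-real s s′ s∈ s′∈ (⊑-sound U V U⊑V s s′ s∈ s′∈ Uss′)

  module _ {u v w : ℕ} (u<v : u < v) (v<w : v < w) (closed-uw : Closed u w) (sep : Separates u v w) where
    private
      uv? = E? u v
      vw? = E? v w

    module Glue {L R s s′} (K : Composite (does uv?) (does vw?) L R s s′) {cℓ cr : ℕ → Fin k}
      (ℓ : Realises cℓ u v (state (colour s) (top s) (Composite.nₗ K)) (state (Composite.y K) (Composite.t K) (Composite.a K)))
      (𝓇 : Realises cr v w (state (Composite.y K) (Composite.t K) (Composite.b K)) (state (colour s′) (top s′) (Composite.nᵣ K))) where
      open Composite K renaming (y to 𝑦; t to 𝑡)
      private
        module ℓ = Realises ℓ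
        module 𝓇 = Realises 𝓇

      c : ℕ → Fin k
      c y with y ℕ.≤? v
      ... | yes _ = cℓ y
      ... | no _  = cr y
      c-left : ∀ {y} → y ≤ v → c y ≡ cℓ y
      c-left {y} y≤v with y ℕ.≤? v
      ... | yes _ = refl
      ... | no y≰v = contradiction y≤v y≰v
      c-right : ∀ {y} → v ≤ y → c y ≡ cr y
      c-right {y} v≤y with y ℕ.≤? v
      ... | no _ = refl
      ... | yes y≤v with ℕ.≤-antisym y≤v v≤y
      ... | refl = trans ℓ.right (sym 𝓇.left)
      cv : c v ≡ 𝑦
      cv = trans (c-left ℕ.≤-refl) ℓ.right
      cu : c u ≡ colour s
      cu = trans (c-left (ℕ.<⇒≤ u<v)) ℓ.left
      cw : c w ≡ colour s′
      cw = trans (c-right (ℕ.<⇒≤ v<w)) 𝓇.right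

      data Side (y : ℕ) : Set where
        at-u : y ≡ u → Side y
        in-l : Between u v y → Side y
        at-v : y ≡ v → Side y
        in-r : Between v w y → Side y
        at-w : y ≡ w → Side y
      side : ∀ {y} → u ≤ y → y ≤ w → Side y
      side {y} u≤y y≤w with ℕ.<-cmp y v
      ... | tri< y<v _ _ = [ (λ u<y → in-l (u<y , y<v)) , at-u ∘ sym ]′ (ℕ.m≤n⇒m<n∨m≡n u≤y)
      ... | tri≈ _ y≡v _ = at-v y≡v
      ... | tri> _ _ v<y = [ (λ y<w → in-r (v<y , y<w)) , at-w ]′ (ℕ.m≤n⇒m<n∨m≡n y≤w)

      good-l : ∀ {x} → Between u v x → Good c x
      good-l uxv = good-cong (λ
        { (inj₁ refl) → sym (c-left (ℕ.<⇒≤ (proj₂ uxv)))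
        ; (inj₂ xy) → sym (c-left (proj₂ (closed-left v<w closed-uw sep uxv xy))) }) (ℓ.good uxv)
      good-r : ∀ {x} → Between v w x → Good c x
      good-r vxw = good-cong (λ
        { (inj₁ refl) → sym (c-right (ℕ.<⇒≤ (proj₁ vxw)))
        ; (inj₂ xy) → sym (c-right (proj₁ (closed-right u<v closed-uw sep vxw xy))) }) (𝓇.good vxw)

      good-v : Good c v
      good-v = proper , inj₂ (𝑡 , satisfied)
        where
        proper : ∀ {y} → E v y → c v ≢ c y
        proper vy cv≡cy with closed-uw (u<v , v<w) vy
        ... | u≤y , y≤w with side u≤y y≤w
        ... | at-u refl = y≢x (does⁺ uv? (E-sym vy)) (trans (sym cv) (trans cv≡cy cu))
        ... | in-l uyv = proj₁ (good-l uyv) (E-sym vy) (sym cv≡cy)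
        ... | at-v refl = E-irrefl vy
        ... | in-r vyw = proj₁ (good-r vyw) (E-sym vy) (sym cv≡cy)
        ... | at-w refl = y≢x′ (does⁺ vw? vy) (trans (sym cv) (trans cv≡cy cw))
        -- What `v` sees is decomposed into `v` itself, the two ends, and the inner neighbours on
        -- either side; `total` is the sum of their loads.
        satisfied : Load c (Sees v) 𝑡 1
        satisfied = load-cong 1 to from (λ _ → refl) (subst (Load c _ 𝑡) total
          (load-∪ (loadIf closed 𝑦 𝑡 + (loadIf (does uv?) (colour s) 𝑡 + loadIf (does vw?) (colour s′) 𝑡)) (toℕ a + toℕ b)
            (load-∪ (loadIf closed 𝑦 𝑡) _ (subst (λ x → Load c _ 𝑡 (loadIf closed x 𝑡)) cv (load-single c closed v 𝑡))
              (load-∪ (loadIf (does uv?) (colour s) 𝑡) (loadIf (does vw?) (colour s′) 𝑡)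
                (subst (λ x → Load c _ 𝑡 (loadIf (does uv?) x 𝑡)) cu (load-single c (does uv?) u 𝑡))
                (subst (λ x → Load c _ 𝑡 (loadIf (does vw?) x 𝑡)) cw (load-single c (does vw?) w 𝑡))))
            (load-∪ (toℕ a) (toℕ b)
              (load-cong (toℕ a) id id (λ ((_ , y<v) , _) → sym (c-left (ℕ.<⇒≤ y<v))) ℓ.right-load)
              (load-cong (toℕ b) id id (λ ((v<y , _) , _) → sym (c-right (ℕ.<⇒≤ v<y))) 𝓇.left-load))))
          where
          to : ∀ {y} → _ → Sees v y
          to (inj₁ (inj₁ own)) = inj₂ own
          to (inj₁ (inj₂ (inj₁ (uv , refl)))) = inj₁ (E-sym (does⁻ uv? uv))
          to (inj₁ (inj₂ (inj₂ (vw , refl)))) = inj₁ (does⁻ vw? vw)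
          to (inj₂ (inj₁ (_ , vy))) = inj₁ vy
          to (inj₂ (inj₂ (_ , vy))) = inj₁ vy
          from : ∀ {y} → Sees v y → _
          from (inj₂ own) = inj₁ (inj₁ own)
          from (inj₁ vy) with closed-uw (u<v , v<w) vy
          ... | u≤y , y≤w with side u≤y y≤w
          ... | at-u refl = inj₁ (inj₂ (inj₁ (does⁺ uv? (E-sym vy) , refl)))
          ... | in-l uyv  = inj₂ (inj₁ (uyv , vy))
          ... | at-v refl = contradiction vy E-irrefl
          ... | in-r vyw  = inj₂ (inj₂ (vyw , vy))
          ... | at-w refl = inj₁ (inj₂ (inj₂ (does⁺ vw? vy , refl)))

      good : ∀ {x} → Between u w x → Good c x
      good (u<x , x<w) with side (ℕ.<⇒≤ u<x) (ℕ.<⇒≤ x<w)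
      ... | at-u refl = contradiction u<x (ℕ.<-irrefl refl)
      ... | in-l uxv  = good-l uxv
      ... | at-v refl = good-v
      ... | in-r vxw  = good-r vxw
      ... | at-w refl = contradiction x<w (ℕ.<-irrefl refl)

      left-load : Load c (Inner u w u) (top s) (toℕ (hits s))
      left-load = load-cong (toℕ (hits s)) to from (λ _ → refl) (subst (Load c _ (top s)) left-hits
        (load-∪ _ (loadIf (does uv?) 𝑦 (top s))
          (load-cong _ id id (λ ((_ , y<v) , _) → sym (c-left (ℕ.<⇒≤ y<v))) ℓ.left-load)
          (subst (λ x → Load c _ (top s) (loadIf (does uv?) x (top s))) cv (load-single c (does uv?) v (top s)))))
        where
        to : ∀ {y} → Inner u v u y ⊎ T (does uv?) × y ≡ v → Inner u w u y
        to (inj₁ ((u<y , y<v) , uy)) = (u<y , ℕ.<-trans y<v v<w) , uy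
        to (inj₂ (uv , refl)) = (u<v , v<w) , does⁻ uv? uv
        from : ∀ {y} → Inner u w u y → Inner u v u y ⊎ T (does uv?) × y ≡ v
        from {y} ((u<y , y<w) , uy) with ℕ.<-cmp y v
        ... | tri< y<v _ _  = inj₁ ((u<y , y<v) , uy)
        ... | tri≈ _ refl _ = inj₂ (does⁺ uv? uy , refl)
        ... | tri> _ _ v<y  = contradiction (proj₂ (sep ℕ.≤-refl u<v v<y (ℕ.<⇒≤ y<w) uy)) (ℕ.<⇒≢ y<w)

      right-load : Load c (Inner u w w) (top s′) (toℕ (hits s′))
      right-load = load-cong (toℕ (hits s′)) to from (λ _ → refl) (subst (Load c _ (top s′)) right-hits
        (load-∪ _ (loadIf (does vw?) 𝑦 (top s′))
          (load-cong _ id id (λ ((v<y , _) , _) → sym (c-right (ℕ.<⇒≤ v<y))) 𝓇.right-load)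
          (subst (λ x → Load c _ (top s′) (loadIf (does vw?) x (top s′))) cv (load-single c (does vw?) v (top s′)))))
        where
        to : ∀ {y} → Inner v w w y ⊎ T (does vw?) × y ≡ v → Inner u w w y
        to (inj₁ ((v<y , y<w) , wy)) = (ℕ.<-trans u<v v<y , y<w) , wy
        to (inj₂ (vw , refl)) = (u<v , v<w) , E-sym (does⁻ vw? vw)
        from : ∀ {y} → Inner u w w y → Inner v w w y ⊎ T (does vw?) × y ≡ v
        from {y} ((u<y , y<w) , wy) with ℕ.<-cmp y v
        ... | tri> _ _ v<y  = inj₁ ((v<y , y<w) , wy)
        ... | tri≈ _ refl _ = inj₂ (does⁺ vw? (E-sym wy) , refl)
        ... | tri< y<v _ _  = contradiction (sym (proj₁ (sep (ℕ.<⇒≤ u<y) y<v v<w ℕ.≤-refl (E-sym wy)))) (ℕ.<⇒≢ u<y)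

      realises : Realises c u w s s′
      realises = record
        { left       = cu
        ; right      = cw
        ; good       = good
        ; left-load  = left-load
        ; right-load = right-load
        }

    compose-realisable : ∀ {L R} → Realisable u v L → Realisable v w R →
      Realisable u w (compose (does uv?) (does vw?) L R)
    compose-realisable {L} {R} L-real R-real s s′ s∈ s′∈ LRss′ =
      let K = composite (does uv?) (does vw?) L R s s′ LRss′
          open Composite K
          _ , ℓ = L-real _ _ s∈ known left
          _ , 𝓇 = R-real _ _ known s′∈ right
      in _ , Glue.realises K ℓ 𝓇

-- Induction over intervals.

all-T : ∀ {A : Set} (p : A → Bool) xs → T (all p xs) → ∀ {x} → x ∈ xs → T (p x)
all-T p xs ps = All.lookup (all⁺ p xs ps)

any-T : ∀ {A : Set} (p : A → Bool) xs → T (any p xs) → ∃ λ x → x ∈ xs × T (p x)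
any-T p xs = find ∘ any⁻ p xs

Idle : ∀ {k} → State k → Set
Idle s = toℕ (State.hits s) ≡ 0

-- A finite certificate: for every closed interval some member of `𝓕` is realisable, and for one
-- whose left end has no neighbours inside, some member of `𝓑`. The type `e` is for intervals with
-- both ends free.
record ClosedFamily (k : ℕ) (closed : Bool) : Set where
  field
    kinds  : List (Fin k × Fin k)
    c₀     : Fin k
    𝓑 𝓕    : List (Type k)
    𝓑⊆𝓕    : ∀ {U} → U ∈ 𝓑 → U ∈ 𝓕
    e      : Type k
    e∈𝓑    : e ∈ 𝓑
    e-idle : ∀ s s′ → T (e s s′) → Idle s × Idle s′
    check  : T (Types.Family.closedUnderComposition closed kinds 𝓑 𝓕)

module Induction {k : ℕ} {closed : Bool} (C : ClosedFamily k closed) (L : LinearGraph) where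
  open ClosedFamily C
  open LinearGraph L
  open Types closed kinds
  open Intervals closed kinds L
  open State

  open Family 𝓑 𝓕 hiding (closedUnderComposition)

  private
    checks : T (all (λ L → all (attached L) 𝓕) 𝓕) × T (all (λ L → all (detached L) 𝓕) 𝓑)
    checks = ∧-T {all (λ L → all (attached L) 𝓕) 𝓕} {all (λ L → all (detached L) 𝓕) 𝓑} check

    attached-T : ∀ {L R} → L ∈ 𝓕 → R ∈ 𝓕 →
      T (covered 𝓕 true true L R) × T (covered 𝓕 true false L R) × T (rooted (compose true false L R))
    attached-T {L} {R} L∈ R∈ =
      let p , q = ∧-T {covered 𝓕 true true L R} {covered 𝓕 true false L R ∧ rooted (compose true false L R)}
            (all-T (attached L) 𝓕 (all-T (λ L → all (attached L) 𝓕) 𝓕 (proj₁ checks) L∈) R∈)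
      in p , ∧-T {covered 𝓕 true false L R} {rooted (compose true false L R)} q

  two-sided : ∀ vw {L R} → L ∈ 𝓕 → R ∈ 𝓕 → ∃ λ U → U ∈ 𝓕 × T (U ⊑ compose true vw L R)
  two-sided true  {L} {R} L∈ R∈ = any-T (_⊑ compose true true L R) 𝓕 (proj₁ (attached-T L∈ R∈))
  two-sided false {L} {R} L∈ R∈ = any-T (_⊑ compose true false L R) 𝓕 (proj₁ (proj₂ (attached-T L∈ R∈)))

  root : ∀ {L R} → L ∈ 𝓕 → R ∈ 𝓕 → T (rooted (compose true false L R))
  root L∈ R∈ = proj₂ (proj₂ (attached-T L∈ R∈))

  one-sided : ∀ {L R} → L ∈ 𝓑 → R ∈ 𝓕 → ∃ λ U → U ∈ 𝓑 × T (U ⊑ compose false true L R)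
  one-sided {L} {R} L∈ R∈ = any-T (_⊑ compose false true L R) 𝓑
    (all-T (detached L) 𝓕 (all-T (λ L → all (detached L) 𝓕) 𝓑 (proj₂ checks) L∈) R∈)

  LeftFree RightFree : ℕ → ℕ → Set
  LeftFree  u w = ∀ {y} → u < y → y < w → ¬ E u y
  RightFree u w = ∀ {y} → u < y → y < w → ¬ E y w

  Colourable : ℕ → ℕ → Set
  Colourable u w = ∃ λ c → ∀ {x} → Between u w x → Good c x

  -- Between two free ends whole components can lie that are linked to neither end. No end state
  -- controls them, so `free` claims a colouring of the inside alone.
  record Result (u w : ℕ) : Set where
    field
      general  : ∃ λ U → U ∈ 𝓕 × Realisable u w U
      leftFree : LeftFree u w → ∃ λ U → U ∈ 𝓑 × Realisable u w U
      free     : LeftFree u w → RightFree u w → Colourable u w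
  open Result

  -- No inner vertex is adjacent to an end, so both ends can be recoloured at will.
  colourable⇒realisable : ∀ {u w} → u < w → LeftFree u w → RightFree u w → Colourable u w → Realisable u w e
  colourable⇒realisable {u} {w} u<w left-free right-free (c , good) s s′ _ _ ess′ = c′ , record
    { left       = at-u
    ; right      = at-w
    ; good       = λ uxw → good-cong (elsewhere uxw) (good uxw)
    ; left-load  = subst (Load c′ _ (top s)) (sym (proj₁ (e-idle s s′ ess′)))
        λ { y ((u<y , y<w) , uy) → contradiction uy (left-free u<y y<w) }
    ; right-load = subst (Load c′ _ (top s′)) (sym (proj₂ (e-idle s s′ ess′)))
        λ { y ((u<y , y<w) , wy) → contradiction (E-sym wy) (right-free u<y y<w) }
    }
    where
    c′ : ℕ → Fin k
    c′ y with y ℕ.≟ u | y ℕ.≟ w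
    ... | yes _ | _     = colour s
    ... | no _  | yes _ = colour s′
    ... | no _  | no _  = c y
    at-u : c′ u ≡ colour s
    at-u with u ℕ.≟ u
    ... | yes _ = refl
    ... | no u≢u = contradiction refl u≢u
    at-w : c′ w ≡ colour s′
    at-w with w ℕ.≟ u | w ℕ.≟ w
    ... | yes refl | _ = contradiction u<w (ℕ.<-irrefl refl)
    ... | no _ | yes _ = refl
    ... | no _ | no w≢w = contradiction refl w≢w
    elsewhere : ∀ {x} → Between u w x → ∀ {y} → y ≡ x ⊎ E x y → c y ≡ c′ y
    elsewhere {x} (u<x , x<w) {y} x-y with y ℕ.≟ u | y ℕ.≟ w
    elsewhere (u<x , x<w) (inj₁ refl) | yes refl | _ = contradiction u<x (ℕ.<-irrefl refl)
    elsewhere (u<x , x<w) (inj₂ xu) | yes refl | _ = contradiction (E-sym xu) (left-free u<x x<w)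
    elsewhere (u<x , x<w) (inj₁ refl) | no _ | yes refl = contradiction x<w (ℕ.<-irrefl refl)
    elsewhere (u<x , x<w) (inj₂ xw) | no _ | yes refl = contradiction xw (right-free u<x x<w)
    elsewhere _ _ | no _ | no _ = refl

  free⇒result : ∀ {u w} → u < w → LeftFree u w → RightFree u w → Colourable u w → Result u w
  free⇒result u<w left-free right-free colourable = record
    { general  = e , 𝓑⊆𝓕 e∈𝓑 , realisable
    ; leftFree = λ _ → e , e∈𝓑 , realisable
    ; free     = λ _ _ → colourable
    }
    where realisable = colourable⇒realisable u<w left-free right-free colourable

  isolated-good : ∀ {x} c → (∀ {y} → ¬ E x y) → Good c x
  isolated-good {x} c isolated = (λ xy → contradiction xy isolated) , sat closed refl
    where
    sat : ∀ b → closed ≡ b → (∀ {y} → ¬ Sees x y) ⊎ ∃ λ m → Load c (Sees x) m 1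
    sat false refl = inj₁ λ { (inj₁ xy) → isolated xy }
    sat true refl = inj₂ (c x , x , inj₂ (tt , refl) , refl ,
      λ { y (inj₁ xy) _ → contradiction xy isolated ; y (inj₂ (_ , y≡x)) y≢x → contradiction y≡x y≢x })

  realised-root : ∀ {x w c s s′} → Realises c x w s s′ → (∀ {y} → E x y → Between x w y) →
    loadIf closed (colour s) (top s) + toℕ (hits s) ≡ 1 → Good c x
  realised-root {x} {w} {c} {s} real within total =
    (λ xy eq → proj₁ (ℛ.good (within xy)) (E-sym xy) (sym eq)) ,
    inj₂ (top s , load-cong 1 to from (λ _ → refl) (subst (Load c _ (top s)) total
      (load-∪ (loadIf closed (colour s) (top s)) (toℕ (hits s))
        (subst (λ y → Load c _ (top s) (loadIf closed y (top s))) ℛ.left (load-single c closed x (top s)))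
        ℛ.left-load)))
    where
    module ℛ = Realises real
    to : ∀ {y} → T closed × y ≡ x ⊎ Inner x w x y → Sees x y
    to (inj₁ own) = inj₂ own
    to (inj₂ (_ , xy)) = inj₁ xy
    from : ∀ {y} → Sees x y → T closed × y ≡ x ⊎ Inner x w x y
    from (inj₁ xy) = inj₂ (within xy , xy)
    from (inj₂ own) = inj₁ own

  module _ (d : ℕ) (ih : ∀ {u w} → u < w → w ≤ u + d → Closed u w → Result u w) {u w : ℕ}
    (u<w : u < w) (w≤ : w ≤ u + suc d) (closed-uw : Closed u w) where

    private
      left-part : ∀ {v} → v < w → v ≤ u + d
      left-part v<w = ℕ.s≤s⁻¹ (ℕ.≤-trans v<w (ℕ.≤-trans w≤ (ℕ.≤-reflexive (ℕ.+-suc u d))))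

      right-part : ∀ {v} → u < v → w ≤ v + d
      right-part u<v = ℕ.≤-trans w≤ (ℕ.≤-trans (ℕ.≤-reflexive (ℕ.+-suc u d)) (ℕ.+-monoˡ-≤ d u<v))

    farthest-case : ∀ {v} → u < v → v < w → E u v → (∀ {z} → v < z → z < w → ¬ E u z) →
      ∃₂ λ L R → L ∈ 𝓕 × R ∈ 𝓕 × Realisable u w (compose true (does (E? v w)) L R)
    farthest-case {v} u<v v<w uv far
      with ih u<v (left-part v<w) (closed-left v<w closed-uw sep) .general
         | ih v<w (right-part u<v) (closed-right u<v closed-uw sep) .general
      where sep = farthest-separates u<v uv far
    ... | L , L∈ , L-real | R , R∈ , R-real = L , R , L∈ , R∈ ,
      subst (λ b → Realisable u w (compose b (does (E? v w)) L R)) (dec-true (E? u v) uv)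
        (compose-realisable u<v v<w closed-uw (farthest-separates u<v uv far) L-real R-real)

    nearest-case : LeftFree u w → ∀ {v} → u < v → v < w → E v w → (∀ {z} → u < z → z < v → ¬ E z w) →
      ∃ λ U → U ∈ 𝓑 × Realisable u w U
    nearest-case left-free {v} u<v v<w vw near
      with ih u<v (left-part v<w) (closed-left v<w closed-uw sep) .leftFree (λ u<y y<v → left-free u<y (ℕ.<-trans y<v v<w))
         | ih v<w (right-part u<v) (closed-right u<v closed-uw sep) .general
      where sep = nearest-separates v<w vw near left-free
    ... | L , L∈ , L-real | R , R∈ , R-real with one-sided L∈ R∈
    ... | U , U∈ , U⊑ = U , U∈ , realisable-⊑ {U = U} {compose false true L R} U⊑
      (subst₂ (λ b b′ → Realisable u w (compose b b′ L R)) (dec-false (E? u v) (left-free u<v v<w)) (dec-true (E? v w) vw)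
        (compose-realisable u<v v<w closed-uw (nearest-separates v<w vw near left-free) L-real R-real))

  -- With both ends free the first vertex x of the interval is the root of a component inside it.
  module _ (d : ℕ) (ih : ∀ {u w} → u < w → w ≤ u + d → Closed u w → Result u w) {u w : ℕ}
    (x<w : suc u < w) (w≤ : w ≤ u + suc d) (closed-uw : Closed u w)
    (left-free : LeftFree u w) (right-free : RightFree u w) where

    private
      x = suc u

      within : ∀ {y z} → Between u w y → E y z → Between u w z
      within (u<y , y<w) yz with closed-uw (u<y , y<w) yz
      ... | u≤z , z≤w = ℕ.≤∧≢⇒< u≤z (λ { refl → left-free u<y y<w (E-sym yz) }) ,
                        ℕ.≤∧≢⇒< z≤w (λ { refl → right-free u<y y<w yz })

      within-x : ∀ {y} → E x y → Between x w y
      within-x xy with within (ℕ.≤-refl , x<w) xy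
      ... | u<y , y<w = ℕ.≤∧≢⇒< u<y (λ { refl → E-irrefl xy }) , y<w

      closed-xw : Closed x w
      closed-xw (x<y , y<w) yz with within (ℕ.<-trans ℕ.≤-refl x<y , y<w) yz
      ... | u<z , z<w = u<z , ℕ.<⇒≤ z<w

      w≤x+d : w ≤ x + d
      w≤x+d = ℕ.≤-trans w≤ (ℕ.≤-reflexive (ℕ.+-suc u d))

    add-root : ∀ {c} → Good c x → (∀ {y} → Between x w y → Good c y) → Colourable u w
    add-root {c} good-x good = c , λ { (u<y , y<w) → [ (λ x<y → good (x<y , y<w)) , (λ { refl → good-x }) ]′ (ℕ.m≤n⇒m<n∨m≡n u<y) }

    attach : ∀ {U} → T (rooted U) → Realisable x w U → Colourable u w
    attach {U} rooted-U real with rooted-sound U rooted-U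
    ... | s , s′ , s∈ , s′∈ , done , Uss′ with real s s′ s∈ s′∈ Uss′
    ... | c , realises = add-root (realised-root realises within-x (ℕ.≡ᵇ⇒≡ (loadIf closed (colour s) (top s) + toℕ (hits s)) 1 done)) (Realises.good realises)

    colour-free : Colourable u w
    colour-free with last (λ y → (x ℕ.<? y) ×-dec E? x y) w
    ... | inj₂ none with ih x<w w≤x+d closed-xw .free (λ x<y y<w xy → none y<w (x<y , xy))
                           (λ x<y y<w → right-free (ℕ.<-trans ℕ.≤-refl x<y) y<w)
    ...   | c , good = add-root (isolated-good c λ xy → none (proj₂ (within-x xy)) (proj₁ (within-x xy) , xy)) good
    -- Here `v` is the last neighbour of the root `x`. It is not adjacent to `w`, whence the flag
    -- `false`, and `rooted` selects a pair of states that satisfies `x`.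
    colour-free | inj₁ (v , v<w , (x<v , xv) , far)
      with farthest-case d ih x<w (ℕ.≤-trans w≤x+d (ℕ.+-monoʳ-≤ x (ℕ.n≤1+n d))) closed-xw x<v v<w xv (λ v<z z<w xz → far v<z z<w (ℕ.<-trans x<v v<z , xz))
    ... | L , R , L∈ , R∈ , real = attach {compose true false L R} (root L∈ R∈)
      (subst (λ b → Realisable x w (compose true b L R)) (dec-false (E? v w) (right-free (ℕ.<-trans ℕ.≤-refl x<v) v<w)) real)

  -- The interval is split at the last inner neighbour of `u`; if there is none, at the first inner
  -- neighbour of `w`; if that is missing too, both ends are free. The induction is on the bound `d`
  -- for the length.
  result : ∀ d {u w} → u < w → w ≤ u + d → Closed u w → Result u w
  result zero u<w w≤u _ = contradiction (ℕ.≤-trans u<w (ℕ.≤-trans w≤u (ℕ.≤-reflexive (ℕ.+-identityʳ _)))) (ℕ.<-irrefl refl)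
  result (suc d) {u} {w} u<w w≤ closed-uw with last (λ y → (u ℕ.<? y) ×-dec E? u y) w
  ... | inj₁ (v , v<w , (u<v , uv) , far)
    with farthest-case d (result d) u<w w≤ closed-uw u<v v<w uv (λ v<z z<w uz → far v<z z<w (ℕ.<-trans u<v v<z , uz))
  ... | L , R , L∈ , R∈ , real with two-sided (does (E? v w)) L∈ R∈
  ... | U , U∈ , U⊑ = record
    { general  = U , U∈ , realisable-⊑ {U = U} {compose true (does (E? v w)) L R} U⊑ real
    ; leftFree = λ left-free → contradiction uv (left-free u<v v<w)
    ; free     = λ left-free → contradiction uv (left-free u<v v<w)
    }
  result (suc d) {u} {w} u<w w≤ closed-uw | inj₂ none with first (λ y → (u ℕ.<? y) ×-dec E? y w) w
  ... | inj₁ (v , v<w , (u<v , vw) , near) = record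
    { general  = U , 𝓑⊆𝓕 U∈ , real
    ; leftFree = λ _ → U , U∈ , real
    ; free     = λ _ right-free → contradiction vw (right-free u<v v<w)
    }
    where
    one = nearest-case d (result d) u<w w≤ closed-uw (λ u<y y<w uy → none y<w (u<y , uy)) u<v v<w vw
      (λ u<z z<v zw → near z<v (u<z , zw))
    U = proj₁ one
    U∈ = proj₁ (proj₂ one)
    real = proj₂ (proj₂ one)
  ... | inj₂ none′ = free⇒result u<w left-free right-free colourable
    where
    left-free : LeftFree u w
    left-free u<y y<w uy = none y<w (u<y , uy)
    right-free : RightFree u w
    right-free u<y y<w yw = none′ y<w (u<y , yw)
    colourable : Colourable u w
    colourable with ℕ.m≤n⇒m<n∨m≡n u<w
    ... | inj₁ x<w = colour-free d (result d) x<w w≤ closed-uw left-free right-free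
    ... | inj₂ refl = (λ _ → c₀) , λ (u<x , x<w) → contradiction u<x (ℕ.<⇒≱ x<w)

  -- The places 0 and `N` carry no edges, so all edges lie in one interval with two free ends.
  colourable : ∀ N → (∀ {x y} → E x y → Between 0 N x) → ∃ λ c → ∀ x → Good c x
  colourable zero bounded = (λ _ → c₀) , λ x → isolated-good _ λ xy → contradiction (proj₂ (bounded xy)) λ ()
  colourable N@(suc _) bounded with result N (s≤s z≤n) ℕ.≤-refl closed₀
                            .free (λ _ _ 0y → ℕ.<-irrefl refl (proj₁ (bounded 0y)))
                                  (λ _ _ yN → ℕ.<-irrefl refl (proj₂ (bounded (E-sym yN))))
    where
    closed₀ : Closed 0 N
    closed₀ _ xy = z≤n , ℕ.<⇒≤ (proj₂ (bounded (E-sym xy)))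
  ... | c , good = c , good′
    where
    good′ : ∀ x → Good c x
    good′ x with (0 ℕ.<? x) ×-dec (x ℕ.<? N)
    ... | yes 0xN = good 0xN
    ... | no outside = isolated-good c λ xy → outside (bounded xy)

-- The two concrete families for five colours.

-- Intervals whose types are below those of all intervals: the empty one, the ones with a free
-- end whose other end carries an arbitrarily complicated graph (the states left to that end in
-- the worst case are the pendant ones), and the composites of these needed to close the family.
module Families (closed : Bool) (kinds : List (Fin 5 × Fin 5)) where
  open Types closed kinds

  -- The induction relies on `empty-idle`, on the two facts about membership and on the closure
  -- check. The thresholds in `pendant` are thereby justified by that check alone.
  idle admissible pendant : State 5 → Bool
  idle       (state _ _ n) = toℕ n ≡ᵇ 0
  admissible (state x m n) = loadIf closed x m + toℕ n <ᵇ 2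
  pendant    (state x m _) = ((2 ≤ᵇ toℕ x) ∨ (toℕ m ≡ᵇ 4)) ∧ (2 ≤ᵇ toℕ m)

  empty worst worstᵀ : Type 5
  empty  = memo λ s s′ → idle s ∧ (idle s′ ∧ (admissible s ∧ admissible s′))
  worst  = memo λ s s′ → idle s ∧ (admissible s ∧ (admissible s′ ∧ pendant s′))
  worstᵀ = memo λ s s′ → worst s′ s

  infixr 6 _△_ _∧̇_
  _△_ _∧̇_ : Type 5 → Type 5 → Type 5
  L △ R = memo (compose true true L R)
  L ∧̇ R = memo (compose true false L R)

  empty-idle : ∀ s s′ → T (empty s s′) → Idle s × Idle s′
  empty-idle s s′ p with ∧-T {idle s} (subst T (memo-≡ (λ s s′ → idle s ∧ (idle s′ ∧ (admissible s ∧ admissible s′))) s s′) p)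
  ... | idle-s , p with ∧-T {idle s′} p
  ... | idle-s′ , _ = ℕ.≡ᵇ⇒≡ _ 0 idle-s , ℕ.≡ᵇ⇒≡ _ 0 idle-s′

  opaque
    bases : List (Type 5)
    bases = empty ∷ worst ∷ []

    -- Common parts are passed as arguments in order to be evaluated once.
    compounds family : List (Type 5)
    compounds = composites empty worst worstᵀ
      where
      composites₂ : Type 5 → Type 5 → Type 5 → Type 5 → Type 5 → Type 5 → List (Type 5)
      composites₂ e p q t et ep =
        q △ p ∷ t △ p ∷ q △ t ∷ ep ∷ q △ e ∷ q ∷ t ∷ et ∷ t △ e ∷ t △ t ∷
        e ∧̇ ep ∷ q ∧̇ t ∷ e ∧̇ et ∷ t ∧̇ t ∷ e ∧̇ t ∷ []
      composites₁ : Type 5 → Type 5 → Type 5 → Type 5 → List (Type 5)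
      composites₁ e p q t = composites₂ e p q t (e △ t) (e △ p)
      composites : Type 5 → Type 5 → Type 5 → List (Type 5)
      composites e p q = composites₁ e p q (e △ e)

    family = compounds ++ bases

    empty∈bases : empty ∈ bases
    empty∈bases = here refl

    bases⊆family : ∀ {U} → U ∈ bases → U ∈ family
    bases⊆family = ∈-++⁺ʳ compounds

-- Found by a computer search.
openKinds closedKinds : List (Fin 5 × Fin 5)
openKinds =
  (0F , 4F) ∷ (0F , 3F) ∷ (0F , 2F) ∷ (1F , 4F) ∷ (1F , 3F) ∷ (1F , 2F) ∷ (1F , 0F) ∷
  (2F , 4F) ∷ (2F , 3F) ∷ (2F , 1F) ∷ (3F , 4F) ∷ (3F , 2F) ∷ (3F , 1F) ∷
  (4F , 3F) ∷ (4F , 2F) ∷ (4F , 1F) ∷ (4F , 0F) ∷ []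
closedKinds =
  (0F , 4F) ∷ (0F , 3F) ∷ (0F , 2F) ∷ (1F , 4F) ∷ (1F , 3F) ∷ (1F , 2F) ∷
  (2F , 4F) ∷ (2F , 2F) ∷ (3F , 3F) ∷ (4F , 4F) ∷ []

-- Proper colourings with three colours.

module ThreeColouring (L : LinearGraph) where
  open LinearGraph L

  separator : ∀ {u w} → suc u < w → ∃ λ v → u < v × v < w × Separates u v w
  separator {u} {w} x<w with last (λ y → (u ℕ.<? y) ×-dec E? u y) w
  ... | inj₁ (v , v<w , (u<v , uv) , far) = v , u<v , v<w ,
    farthest-separates u<v uv (λ v<z z<w uz → far v<z z<w (ℕ.<-trans u<v v<z , uz))
  ... | inj₂ free with first (λ y → (u ℕ.<? y) ×-dec E? y w) w
  ... | inj₁ (v , v<w , (u<v , vw) , near) = v , u<v , v<w ,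
    nearest-separates v<w vw (λ u<z z<v zw → near z<v (u<z , zw)) (λ u<z z<w uz → free z<w (u<z , uz))
  -- Only edges from `u` can pass over `suc u`, and `u` has no inner neighbour.
  ... | inj₂ _ = suc u , ℕ.≤-refl , x<w , sep
    where
    sep : Separates u (suc u) w
    sep u≤y y<x x<z z≤w yz with ℕ.≤-antisym u≤y (ℕ.s≤s⁻¹ y<x) | ℕ.m≤n⇒m<n∨m≡n z≤w
    ... | refl | inj₁ z<w = contradiction (ℕ.<-trans ℕ.≤-refl x<z , yz) (free z<w)
    ... | refl | inj₂ refl = refl , refl

  third : ∀ (a b : Fin 3) → ∃ λ t → t ≢ a × t ≢ b
  third = toWitness {a? = Fin.all? λ a → Fin.all? λ b → Fin.any? λ t → ¬? (t Fin.≟ a) ×-dec ¬? (t Fin.≟ b)} _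

  ProperAt : (ℕ → Fin 3) → ℕ → Set
  ProperAt c x = ∀ {y} → E x y → c x ≢ c y

  Extends : ℕ → ℕ → Fin 3 → Fin 3 → Set
  Extends u w a b = ∃ λ c → c u ≡ a × c w ≡ b × (∀ {x} → Between u w x → ProperAt c x)

  glue : ∀ {u v w a t b} → u < v → v < w → Closed u w → Separates u v w → t ≢ a → t ≢ b →
    Extends u v a t → Extends v w t b → Extends u w a b
  glue {u} {v} {w} {a} {t} {b} u<v v<w closed sep t≢a t≢b (cℓ , cℓu , cℓv , proper-ℓ) (cr , crv , crw , proper-r) =
    c , cu , cw , proper
    where
    c : ℕ → Fin 3
    c y with y ℕ.≤? v
    ... | yes _ = cℓ y
    ... | no _  = cr y
    c-left : ∀ {y} → y ≤ v → c y ≡ cℓ y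
    c-left {y} y≤v with y ℕ.≤? v
    ... | yes _ = refl
    ... | no y≰v = contradiction y≤v y≰v
    c-right : ∀ {y} → v ≤ y → c y ≡ cr y
    c-right {y} v≤y with y ℕ.≤? v
    ... | no _ = refl
    ... | yes y≤v with ℕ.≤-antisym y≤v v≤y
    ... | refl = trans cℓv (sym crv)
    cu : c u ≡ a
    cu = trans (c-left (ℕ.<⇒≤ u<v)) cℓu
    cw : c w ≡ b
    cw = trans (c-right (ℕ.<⇒≤ v<w)) crw
    cv : c v ≡ t
    cv = trans (c-left ℕ.≤-refl) cℓv
    left : ∀ {x} → Between u v x → ProperAt c x
    left uxv xy eq = proper-ℓ uxv xy (trans (sym (c-left (ℕ.<⇒≤ (proj₂ uxv))))
      (trans eq (c-left (proj₂ (closed-left v<w closed sep uxv xy)))))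
    right : ∀ {x} → Between v w x → ProperAt c x
    right vxw xy eq = proper-r vxw xy (trans (sym (c-right (ℕ.<⇒≤ (proj₁ vxw))))
      (trans eq (c-right (proj₁ (closed-right u<v closed sep vxw xy)))))
    middle : ProperAt c v
    middle {y} vy eq with closed (u<v , v<w) vy
    ... | u≤y , y≤w with ℕ.<-cmp y v | ℕ.m≤n⇒m<n∨m≡n u≤y | ℕ.m≤n⇒m<n∨m≡n y≤w
    ... | tri≈ _ refl _ | _         | _         = E-irrefl vy
    ... | tri< y<v _ _  | inj₁ u<y  | _         = left (u<y , y<v) (E-sym vy) (sym eq)
    ... | tri< _ _ _    | inj₂ refl | _         = t≢a (trans (sym cv) (trans eq cu))
    ... | tri> _ _ v<y  | _         | inj₁ y<w  = right (v<y , y<w) (E-sym vy) (sym eq)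
    ... | tri> _ _ _    | _         | inj₂ refl = t≢b (trans (sym cv) (trans eq cw))
    proper : ∀ {x} → Between u w x → ProperAt c x
    proper {x} (u<x , x<w) with ℕ.<-cmp x v
    ... | tri< x<v _ _ = left (u<x , x<v)
    ... | tri≈ _ refl _ = middle
    ... | tri> _ _ v<x = right (v<x , x<w)

  -- The end colours are prescribed independently, even for adjacent ends: that edge is checked
  -- where one of them is the separating vertex of a larger interval. Three colours always leave one
  -- for the separating vertex.
  extends : ∀ d {u w} → u < w → w ≤ u + d → Closed u w → ∀ a b → Extends u w a b
  extends zero u<w w≤u _ _ _ = contradiction (ℕ.≤-trans u<w (ℕ.≤-trans w≤u (ℕ.≤-reflexive (ℕ.+-identityʳ _)))) (ℕ.<-irrefl refl)
  extends (suc d) {u} {w} u<w w≤ closed a b with ℕ.m≤n⇒m<n∨m≡n u<w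
  ... | inj₁ x<w with separator x<w | third a b
  ... | v , u<v , v<w , sep | t , t≢a , t≢b = glue u<v v<w closed sep t≢a t≢b
    (extends d u<v (ℕ.s≤s⁻¹ (ℕ.≤-trans v<w w≤′)) (closed-left v<w closed sep) a t)
    (extends d v<w (ℕ.≤-trans w≤′ (ℕ.+-monoˡ-≤ d u<v)) (closed-right u<v closed sep) t b)
    where
    w≤′ : w ≤ suc (u + d)
    w≤′ = ℕ.≤-trans w≤ (ℕ.≤-reflexive (ℕ.+-suc u d))
  extends (suc d) {u} _ _ _ a b | inj₂ refl = c , at-u , at-w ,
    λ (u<x , x<w) → contradiction u<x (ℕ.<⇒≱ x<w)
    where
    c : ℕ → Fin 3
    c y with y ℕ.≤? u
    ... | yes _ = a
    ... | no _ = b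
    at-u : c u ≡ a
    at-u with u ℕ.≤? u
    ... | yes _ = refl
    ... | no u≰u = contradiction ℕ.≤-refl u≰u
    at-w : c (suc u) ≡ b
    at-w with suc u ℕ.≤? u
    ... | yes 1+u≤u = contradiction 1+u≤u (ℕ.<-irrefl refl)
    ... | no _ = refl

  three-colouring : ∀ N → (∀ {x y} → E x y → Between 0 N x) → ∃ λ c → ∀ x → ProperAt c x
  three-colouring zero bounded = (λ _ → 0F) , λ x xy → contradiction (proj₂ (bounded xy)) λ ()
  three-colouring N@(suc _) bounded
    with extends N (s≤s z≤n) ℕ.≤-refl (λ _ xy → z≤n , ℕ.<⇒≤ (proj₂ (bounded (E-sym xy)))) 0F 0F
  ... | c , _ , _ , proper = c , λ x xy → proper (bounded xy) xy

-- Carrying colourings back to outerplanar graphs.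

bound : ∀ {n} (f : Fin n → ℕ) → ∃ λ N → ∀ i → f i < N
bound {zero} f = 0 , λ ()
bound {suc n} f with bound (f ∘ suc)
... | N , f<N = suc (f zero) ⊔ N , λ
  { zero → ℕ.m≤m⊔n (suc (f zero)) N
  ; (suc i) → ℕ.≤-trans (f<N i) (ℕ.m≤n⊔m (suc (f zero)) N) }

module Transfer {G : Graph} (layout : Layout G) where
  open Layout layout

  -- The shift by one keeps place 0 empty, as the free left end of the outermost interval.
  place : Vertex G → ℕ
  place v = suc (position v)

  -- Each component gets a line of its own, since positions are distinct only within a component.
  linear : Component → LinearGraph
  linear l = record
    { E             = E
    ; E?            = λ x y → Fin.any? λ u → Fin.any? λ v →
        (component u ≟ᶜ l) ×-dec (component v ≟ᶜ l) ×-dec (place u ℕ.≟ x) ×-dec (place v ℕ.≟ y) ×-dec T? (Graph.adjacent G u v)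
    ; E-sym         = λ (u , v , u∈l , v∈l , ux , vy , uv) → v , u , v∈l , u∈l , vy , ux , Adj-sym {G} {u} {v} uv
    ; E-irrefl      = λ (u , v , u∈l , v∈l , ux , vx , uv) → Adj-irrefl {G} {u} {v} uv
        (injective (trans u∈l (sym v∈l)) (ℕ.suc-injective (trans ux (sym vx))))
    ; E-noncrossing = λ { a<c c<b b<d (a , b , a∈l , _ , refl , refl , ab) (c , d , c∈l , _ , refl , refl , cd) →
        noncrossing (trans a∈l (sym c∈l)) (ℕ.s≤s⁻¹ a<c) (ℕ.s≤s⁻¹ c<b) (ℕ.s≤s⁻¹ b<d) ab cd }
    }
    where
    E : ℕ → ℕ → Set
    E x y = ∃₂ λ u v → component u ≡ l × component v ≡ l × place u ≡ x × place v ≡ y × Adj G u v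

  bounded : ∃ λ N → ∀ l {x y} → LinearGraph.E (linear l) x y → LinearGraph.Between (linear l) 0 N x
  bounded with bound place
  ... | N , place<N = N , λ { l (u , _ , _ , _ , refl , _) → s≤s z≤n , place<N u }

  linear-edge : ∀ {u v} → Adj G u v → LinearGraph.E (linear (component u)) (place u) (place v)
  linear-edge {u} {v} uv = u , v , refl , sym (adjacent uv) , refl , refl , uv

  neighbour : ∀ {v x} → LinearGraph.E (linear (component v)) (place v) x →
    ∃ λ u → Adj G v u × place u ≡ x
  neighbour {v} (v′ , u , v′∈ , _ , v′at , uat , vu) with injective v′∈ (ℕ.suc-injective v′at)
  ... | refl = u , vu , uat

  module _ {k} (c : Component → ℕ → Fin k) where
    colouring : Coloring G k
    colouring v = c (component v) (place v)

    colour-adjacent : ∀ {u v} → Adj G u v → colouring v ≡ c (component u) (place v)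
    colour-adjacent {v = v} uv = cong (λ l → c l (place v)) (sym (adjacent uv))

  outerplanar-3-colourable : ∃ λ (c : Coloring G 3) → Proper G c
  outerplanar-3-colourable = colouring c , λ u v uv eq →
    proj₂ (colour (component u)) (place u) (linear-edge uv) (trans eq (colour-adjacent c uv))
    where
    colour : ∀ l → ∃ λ c → ∀ x → ThreeColouring.ProperAt (linear l) c x
    colour l = ThreeColouring.three-colouring (linear l) (proj₁ bounded) (proj₂ bounded l)
    c : Component → ℕ → Fin 3
    c l = proj₁ (colour l)

  module UniqueMaximum {k : ℕ} {closed : Bool} (C : ClosedFamily k closed) where
    private
      module I l = Intervals closed (ClosedFamily.kinds C) (linear l)

      colour : ∀ l → ∃ λ c → ∀ x → I.Good l c x
      colour l = Induction.colourable C (linear l) (proj₁ bounded) (proj₂ bounded l)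

      c : Component → ℕ → Fin k
      c l = proj₁ (colour l)

    Neighbourhood : Vertex G → Pred (Vertex G) 0ℓ
    Neighbourhood v u = T closed × u ≡ v ⊎ Adj G v u

    good : (∀ v → ∃ (Neighbourhood v)) → ∃ λ (c : Coloring G k) → Proper G c × (∀ v → ∃ λ m → Load c (Neighbourhood v) m 1)
    good nonempty = colouring c ,
      (λ u v uv eq → proj₁ (proj₂ (colour (component u)) (place u)) (linear-edge uv) (trans eq (colour-adjacent c uv))) ,
      satisfied
      where
      sees : ∀ {v u} → Neighbourhood v u → I.Sees (component v) (place v) (place u)
      sees (inj₁ (own , refl)) = inj₂ (own , refl)
      sees (inj₂ vu) = inj₁ (linear-edge vu)
      seen : ∀ {v x} → I.Sees (component v) (place v) x → ∃ λ u → Neighbourhood v u × place u ≡ x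
      seen (inj₁ vx) with neighbour vx
      ... | u , vu , ux = u , inj₂ vu , ux
      seen (inj₂ (own , refl)) = _ , inj₁ (own , refl) , refl
      same-component : ∀ {v u} → Neighbourhood v u → component v ≡ component u
      same-component (inj₁ (_ , refl)) = refl
      same-component (inj₂ vu) = adjacent vu
      colour-seen : ∀ {v u} → Neighbourhood v u → colouring c u ≡ c (component v) (place u)
      colour-seen {u = u} vu = cong (λ l → c l (place u)) (sym (same-component vu))
      satisfied : ∀ v → ∃ λ m → Load (colouring c) (Neighbourhood v) m 1
      satisfied v with proj₂ (proj₂ (colour (component v)) (place v))
      ... | inj₁ none = contradiction (sees (proj₂ (nonempty v))) none
      ... | inj₂ (m , z , vz , cz≡m , less) with seen vz
      ...   | u , vu , refl = m , u , vu , trans (colour-seen vu) cz≡m , λ w vw w≢u →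
        subst (Fin._< m) (sym (colour-seen vw)) (less (place w) (sees vw)
          (λ eq → w≢u (injective (trans (sym (same-component vw)) (same-component vu)) (ℕ.suc-injective eq))))

load⇒unique-maximum : ∀ {n k} {c : Fin n → Fin k} {S S′ : Pred (Fin n) 0ℓ} → S ⊆ S′ → S′ ⊆ S →
  (∃ λ m → Load c S m 1) → UniqueMaximumOn c S′
load⇒unique-maximum {c = c} {S} {S′} S⊆S′ S′⊆S (m , z , z∈ , cz≡m , less) =
  m , ((z , S⊆S′ z∈ , cz≡m) , maximal) , z , (S⊆S′ z∈ , cz≡m) , unique
  where
  maximal : ∀ u → S′ u → c u Fin.≤ m
  maximal u u∈ with u Fin.≟ z
  ... | yes refl = ℕ.≤-reflexive (cong toℕ cz≡m)
  ... | no u≢z = ℕ.<⇒≤ (less u (S′⊆S u∈) u≢z)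
  unique : ∀ {u} → S′ u × c u ≡ m → z ≡ u
  unique {u} (u∈ , cu≡m) with u Fin.≟ z
  ... | yes u≡z = sym u≡z
  ... | no u≢z = contradiction (cong toℕ cu≡m) (ℕ.<⇒≢ (less u (S′⊆S u∈) u≢z))

pUMo⇒pCFo : ∀ {G k} {c : Coloring G k} → pUMo G k c → pCFo G k c
pUMo⇒pCFo (proper , um) = proper , λ v → let a , _ , once = um v in a , once

-- The colour of `v` itself appears only once on its closed neighbourhood.
proper⇒pCFc : ∀ {G k} {c : Coloring G k} → Proper G c → pCFc G k c
proper⇒pCFc {c = c} proper = proper , λ v → c v , v , (inj₁ refl , refl) , λ
  { (inj₁ u≡v , _) → sym u≡v
  ; {u} (inj₂ vu , cu≡cv) → contradiction (sym cu≡cv) (proper v u vu) }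

module _ {G : Graph} (outerplanar : Outerplanar G) where
  private
    layout : Layout G
    layout = outerplanar-layout outerplanar

  outerplanar-pCFc : ∃ (pCFc G 3)
  outerplanar-pCFc = let c , proper = Transfer.outerplanar-3-colourable layout in c , proper⇒pCFc {G} proper

  outerplanar-pUMc : ∀ {k} → ClosedFamily k true → ∃ (pUMc G k)
  outerplanar-pUMc C = let c , proper , load = Transfer.UniqueMaximum.good layout C (λ v → v , inj₁ (tt , refl)) in
    c , proper , λ v → load⇒unique-maximum [ inj₁ ∘ proj₂ , inj₂ ]′ [ (λ u≡v → inj₁ (tt , u≡v)) , inj₂ ]′ (load v)

  outerplanar-pUMo : ∀ {k} → ClosedFamily k false → NoIsolatedVertices G → ∃ (pUMo G k)
  outerplanar-pUMo C non-isolated =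
    let c , proper , load = Transfer.UniqueMaximum.good layout C (λ v → let u , vu = non-isolated v in u , inj₂ vu) in
    c , proper , λ v → load⇒unique-maximum [ (λ ()) , id ]′ inj₂ (load v)

-- Exact chromatic numbers by exhaustive search.

-- `χMax` demands the least number of colours for every graph of the class; constructively it has to
-- be found by deciding each smaller number. `respect` is there because the enumeration of
-- colourings reaches each only up to pointwise equality.
record DecidableColoring (P : ColoringType) : Set where
  field
    decide  : ∀ G k → Decidable (P G k)
    respect : ∀ G k {c c′ : Coloring G k} → c ≗ c′ → P G k c → P G k c′

  exists? : ∀ G k → Dec (∃ (P G k))
  exists? G k = map′ (λ (i , p) → finToFun i , p)
    (λ (c , p) → funToFin c , respect G k (λ v → sym (Fin.finToFun-funToFin c v)) p)
    (Fin.any? λ i → decide G k (finToFun {k} {Graph.order G} i))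

  chromatic : ∀ {G k} → ∃ (P G k) → ∃ λ l → χ P G l × l ≤ k
  chromatic {G} {k} coloured with least (exists? G) k coloured
  ... | l , coloured-l , fewer = l , (coloured-l , λ j coloured-j → ℕ.≮⇒≥ (λ j<l → fewer j j<l coloured-j)) ,
    ℕ.≮⇒≥ (λ k<l → fewer k k<l coloured)

  χMax-intro : ∀ {𝒞 : Pred Graph 0ℓ} {k} → (∀ G → 𝒞 G → ∃ (P G k)) →
    (∃ λ G → 𝒞 G × (∀ j → ∃ (P G j) → k ≤ j)) → χMax P 𝒞 k
  χMax-intro upper (G , G∈ , lower) =
    (G , G∈ , upper G G∈ , lower) , λ G G∈ → chromatic (upper G G∈)

module _ {n k : ℕ} {S : Pred (Fin n) 0ℓ} (S? : Decidable S) where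
  module _ (c : Fin n → Fin k) where
    once? : Decidable (AppearsOnceOn c S)
    once? a = Fin.any? λ u → (S? u ×-dec (c u Fin.≟ a)) ×-dec
      map′ (λ unique {y} → unique y) (λ unique y → unique) (Fin.all? λ y → (S? y ×-dec (c y Fin.≟ a)) →-dec (u Fin.≟ y))

    isMax? : Decidable (IsMaxColorOn c S)
    isMax? a = Fin.any? (λ u → S? u ×-dec (c u Fin.≟ a)) ×-dec Fin.all? λ u → S? u →-dec (c u Fin.≤? a)

    conflictFree? : Dec (ConflictFreeOn c S)
    conflictFree? = Fin.any? once?

    uniqueMaximum? : Dec (UniqueMaximumOn c S)
    uniqueMaximum? = Fin.any? λ a → isMax? a ×-dec once? a

module _ {n k : ℕ} {S : Pred (Fin n) 0ℓ} {c c′ : Fin n → Fin k} (c≗c′ : c ≗ c′) where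
  once-respect : ∀ {a} → AppearsOnceOn c S a → AppearsOnceOn c′ S a
  once-respect (u , (u∈ , cu≡a) , unique) = u , (u∈ , trans (sym (c≗c′ u)) cu≡a) ,
    λ (y∈ , c′y≡a) → unique (y∈ , trans (c≗c′ _) c′y≡a)

  conflictFree-respect : ConflictFreeOn c S → ConflictFreeOn c′ S
  conflictFree-respect (a , once) = a , once-respect once

  uniqueMaximum-respect : UniqueMaximumOn c S → UniqueMaximumOn c′ S
  uniqueMaximum-respect (a , ((u , u∈ , cu≡a) , maximal) , once) =
    a , ((u , u∈ , trans (sym (c≗c′ u)) cu≡a) , λ y y∈ → subst (Fin._≤ a) (c≗c′ y) (maximal y y∈)) , once-respect once

module _ (G : Graph) where
  open Graph G using (N; N[_])

  N? : ∀ v → Decidable (N v)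
  N? v u = T? (Graph.adjacent G v u)

  N[]? : ∀ v → Decidable N[ v ]
  N[]? v u = (u Fin.≟ v) ⊎-dec N? v u

  proper? : ∀ {k} (c : Coloring G k) → Dec (Proper G c)
  proper? c = Fin.all? λ u → Fin.all? λ v → N? u v →-dec ¬? (c u Fin.≟ c v)

  proper-respect : ∀ {k} {c c′ : Coloring G k} → c ≗ c′ → Proper G c → Proper G c′
  proper-respect c≗c′ proper u v uv eq = proper u v uv (trans (c≗c′ u) (trans eq (sym (c≗c′ v))))

pCFo-decidable : DecidableColoring pCFo
pCFo-decidable = record
  { decide  = λ G k c → proper? G c ×-dec Fin.all? λ v → conflictFree? (N? G v) c
  ; respect = λ G k c≗c′ (proper , cf) → proper-respect G c≗c′ proper , λ v → conflictFree-respect c≗c′ (cf v)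
  }

pCFc-decidable : DecidableColoring pCFc
pCFc-decidable = record
  { decide  = λ G k c → proper? G c ×-dec Fin.all? λ v → conflictFree? (N[]? G v) c
  ; respect = λ G k c≗c′ (proper , cf) → proper-respect G c≗c′ proper , λ v → conflictFree-respect c≗c′ (cf v)
  }

pUMo-decidable : DecidableColoring pUMo
pUMo-decidable = record
  { decide  = λ G k c → proper? G c ×-dec Fin.all? λ v → uniqueMaximum? (N? G v) c
  ; respect = λ G k c≗c′ (proper , um) → proper-respect G c≗c′ proper , λ v → uniqueMaximum-respect c≗c′ (um v)
  }

pUMc-decidable : DecidableColoring pUMc
pUMc-decidable = record
  { decide  = λ G k c → proper? G c ×-dec Fin.all? λ v → uniqueMaximum? (N[]? G v) c
  ; respect = λ G k c≗c′ (proper , um) → proper-respect G c≗c′ proper , λ v → uniqueMaximum-respect c≗c′ (um v)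
  }

-- Outerplanarity of concrete graphs by evaluation.

module Certificate (G : Graph) .{{_ : NonZero (Graph.order G)}} where
  open Graph G using (order; adjacent; Connected)

  everyVertex : (Vertex G → Bool) → Bool
  everyVertex p = all p (allFin order)

  everyVertex-sound : ∀ p → T (everyVertex p) → ∀ v → T (p v)
  everyVertex-sound p ps v = All.lookup (all⁺ p (allFin order) ps) (∈-allFin v)

  atDart : (Dart G → Bool) → Vertex G → Vertex G → Bool
  atDart p u v with T? (adjacent u v)
  ... | yes uv = p (dart u v uv)
  ... | no _   = true

  atDart-sound : ∀ p d → T (atDart p (tail d) (head d)) → T (p d)
  atDart-sound p (dart u v uv) pd with T? (adjacent u v)
  ... | yes uv′ = subst (λ e → T (p (dart u v e))) (T-irrelevant uv′ uv) pd
  ... | no ¬uv = contradiction uv ¬uv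

  everyDart : (Dart G → Bool) → Bool
  everyDart p = everyVertex λ u → everyVertex (atDart p u)

  everyDart-sound : ∀ p → T (everyDart p) → ∀ d → T (p d)
  everyDart-sound p ps d = atDart-sound p d (everyVertex-sound (atDart p (tail d))
    (everyVertex-sound (λ u → everyVertex (atDart p u)) ps (tail d)) (head d))

  darts : List (Dart G)
  darts = concatMap (λ u → concatMap (dartsBetween u) (allFin order)) (allFin order)
    where
    dartsBetween : ∀ u v → List (Dart G)
    dartsBetween u v with T? (adjacent u v)
    ... | yes uv = dart u v uv ∷ []
    ... | no _   = []

  _==_ : Dart G → Dart G → Bool
  d == e = does (tail d Fin.≟ tail e) ∧ does (head d Fin.≟ head e)

  ==-sound : ∀ d e → T (d == e) → d ≡ e
  ==-sound d e eq with tail d Fin.≟ tail e | head d Fin.≟ head e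
  ... | yes t≡t | yes h≡h = dart-≡ t≡t h≡h

  Orbit : (Dart G → Dart G) → Dart G → Dart G → Set
  Orbit π d e = ∃ λ i → iterate π d i ≡ e

  Orbit-trans : ∀ {π d e f} → Orbit π d e → Orbit π e f → Orbit π d f
  Orbit-trans (zero , refl) e⇝f = e⇝f
  Orbit-trans (suc i , eq) e⇝f with Orbit-trans (i , eq) e⇝f
  ... | j , eq′ = suc j , eq′

  reaches : (Dart G → Dart G) → ℕ → Dart G → Dart G → Bool
  reaches π zero    d e = d == e
  reaches π (suc i) d e = (d == e) ∨ reaches π i (π d) e

  reaches-sound : ∀ π i d e → T (reaches π i d e) → Orbit π d e
  reaches-sound π zero d e r = 0 , ==-sound d e r
  reaches-sound π (suc i) d e r with Equivalence.to (T-∨ {d == e}) r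
  ... | inj₁ d==e = 0 , ==-sound d e d==e
  ... | inj₂ r with reaches-sound π i (π d) e r
  ... | j , eq = suc j , eq

  module _ (π : Dart G → Dart G) where
    private
      reach : Dart G → Dart G → Bool
      -- The number of steps is a guess that suits Hamiltonian outerplanar graphs; too small a
      -- number could only make a check fail.
      reach = reaches π order

    classOf : (r : Dart G) (rs : List (Dart G)) → Dart G → Fin (suc (length rs))
    -- The last representative takes every remaining dart untested; `represented` verifies the
    -- choice afterwards.
    classOf r [] d = zero
    classOf r (r′ ∷ rs) d = if reach r d then zero else suc (classOf r′ rs d)

    represents : (r : Dart G) (rs : List (Dart G)) → Dart G → Fin (suc (length rs)) → Bool
    represents r rs d i = reach d (List.lookup (r ∷ rs) i) ∧ (reach (List.lookup (r ∷ rs) i) d ∧ does (classOf r rs (π d) Fin.≟ i))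

    represented : (r : Dart G) (rs : List (Dart G)) → Bool
    represented r rs = everyDart λ d → represents r rs d (classOf r rs d)

    orbitClasses : ∀ r rs → T (represented r rs) →
      (∀ i → classOf r rs (List.lookup (r ∷ rs) i) ≡ i) → HasClasses (Orbit π) (suc (length rs))
    orbitClasses r rs ok onto = hasClasses class rep onto (λ (i , eq) → invariant i eq)
      λ {d} {e} eq → Orbit-trans (proj₁ (checked d)) (subst (λ i → Orbit π (rep i) e) (sym eq) (proj₁ (proj₂ (checked e))))
      where
      class = classOf r rs
      rep = List.lookup (r ∷ rs)
      checked : ∀ d → Orbit π d (rep (class d)) × Orbit π (rep (class d)) d × class (π d) ≡ class d
      checked d with Equivalence.to (T-∧ {reach d (rep (class d))}) (everyDart-sound (λ d → represents r rs d (class d)) ok d)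
      ... | there′ , rest with Equivalence.to (T-∧ {reach (rep (class d)) d}) rest
      ... | back , stable = reaches-sound π order d _ there′ , reaches-sound π order _ d back , does⁻ (class (π d) Fin.≟ class d) stable
      invariant : ∀ {d e} i → iterate π d i ≡ e → class d ≡ class e
      invariant zero refl = refl
      invariant {d} (suc i) eq = trans (sym (proj₂ (proj₂ (checked d)))) (invariant i eq)

    representatives : List (Dart G)
    representatives = foldr (λ d rs → if any (λ r → reach r d) rs then rs else (d ∷ rs)) [] darts

    orbitClasses? : Maybe (∃ (HasClasses (Orbit π)))
    orbitClasses? = classes representatives
      where
      classes : List (Dart G) → Maybe (∃ (HasClasses (Orbit π)))
      classes [] = nothing
      classes (r ∷ rs) = dec⇒maybe (T? (represented r rs)) >>= λ ok →
        dec⇒maybe (Fin.all? λ i → classOf r rs (List.lookup (r ∷ rs) i) Fin.≟ i) >>= λ onto →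
        just (_ , orbitClasses r rs ok onto)

  -- The neighbours of a vertex are rotated in the cyclic order of the vertices 0, 1, …, so that
  -- the edges are the chords of a polygon.
  sweep : ℕ → Vertex G → Dart G → Dart G
  sweep zero    v d = d
  sweep (suc i) v d with T? (adjacent (tail d) v)
  ... | yes uv = dart (tail d) v uv
  ... | no _   = sweep i (suc (toℕ v) mod order) d

  sweep-tail : ∀ i v d → tail (sweep i v d) ≡ tail d
  sweep-tail zero v d = refl
  sweep-tail (suc i) v d with T? (adjacent (tail d) v)
  ... | yes uv = refl
  ... | no _   = sweep-tail i (suc (toℕ v) mod order) d

  turn : Dart G → Dart G
  turn d = sweep order (suc (toℕ (head d)) mod order) d

  rotation? : Maybe (RotationSystem G)
  rotation? = dec⇒maybe (T? (everyDart λ d → everyDart (cyclic d))) >>= λ ok → just record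
    { next        = turn
    ; next-tail   = λ d → sweep-tail order _ d
    ; next-cyclic = λ d e eq → reaches-sound turn order d e
        (cyclic-sound d e eq (everyDart-sound (cyclic d) (everyDart-sound (λ d → everyDart (cyclic d)) ok d) e))
    }
    where
    cyclic : Dart G → Dart G → Bool
    cyclic d e = not (does (tail d Fin.≟ tail e)) ∨ reaches turn order d e
    cyclic-sound : ∀ d e → tail d ≡ tail e → T (cyclic d e) → T (reaches turn order d e)
    cyclic-sound d e eq ok with tail d Fin.≟ tail e
    ... | yes _ = ok
    ... | no neq = contradiction eq neq

  -- A sufficient criterion: if every vertex other than 0 has a smaller neighbour, descending leads
  -- from each vertex to 0. A numbering along a Hamiltonian outer cycle satisfies it.
  connected? : Maybe (∀ u v → Connected u v)
  connected? = dec⇒maybe (Fin.all? λ v → (toℕ v ℕ.≟ 0) ⊎-dec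
      Fin.any? λ w → (toℕ w ℕ.<? toℕ v) ×-dec T? (adjacent v w)) >>= λ smaller →
    just λ u v →
      let r , r≡0 , u⇝r = descend smaller u (<-wellFounded (toℕ u))
          s , s≡0 , v⇝s = descend smaller v (<-wellFounded (toℕ v))
      in u⇝r ◅◅ subst (λ x → Connected x v) (Fin.toℕ-injective (trans s≡0 (sym r≡0))) (Connected-sym {G} v⇝s)
    where
    descend : (∀ v → toℕ v ≡ 0 ⊎ ∃ λ w → toℕ w < toℕ v × T (adjacent v w)) →
      ∀ v → Acc _<_ (toℕ v) → ∃ λ r → toℕ r ≡ 0 × Connected v r
    descend smaller v (acc rec) with smaller v
    ... | inj₁ v≡0 = v , v≡0 , ε
    ... | inj₂ (w , w<v , vw) with descend smaller w (rec w<v)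
    ... | r , r≡0 , w⇝r = r , r≡0 , vw ◅ w⇝r

  module _ (ρ : RotationSystem G) (connected : ∀ u v → Connected u v) where
    open RotationSystem ρ

    private
      orbit-next : ∀ {d e} → Orbit next d e → SameVertex d e
      orbit-next (zero , refl) = refl
      orbit-next {d} (suc i , eq) = trans (sym (next-tail d)) (orbit-next (i , eq))

      orbit-flip : ∀ {d e} → Orbit flip d e → SameEdge d e
      orbit-flip (zero , eq) = inj₁ eq
      orbit-flip {d} (suc i , eq) with orbit-flip {flip d} (i , eq)
      ... | inj₁ fd≡e = inj₂ fd≡e
      ... | inj₂ refl = inj₁ (sym (flip-flip d))

      flip-orbit : ∀ {d e} → SameEdge d e → Orbit flip d e
      flip-orbit (inj₁ d≡e) = 0 , d≡e
      flip-orbit (inj₂ fd≡e) = 1 , fd≡e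

      single : (i : Fin 1) → zero ≡ i
      single zero = refl

    planar? : Dart G → Maybe Planar
    planar? d = orbitClasses? next >>= λ (V , vertices) → orbitClasses? flip >>= λ (E , edges) →
      orbitClasses? faceStep >>= λ (F , faces) → dec⇒maybe (V + F ℕ.≟ E + 2 * 1) >>= λ euler →
      just (V , E , F , 1 ,
        classes-cong orbit-next (λ {d} {e} → next-cyclic d e) vertices ,
        classes-cong orbit-flip flip-orbit edges , faces ,
        hasClasses (λ _ → zero) (λ _ → d) single (λ _ → refl) (λ _ → connected _ _) , euler)

    outerFace? : Dart G → Maybe AllVerticesOnOuterFace
    -- The vertices are numbered along the outer face, so the walk that starts with the dart from 0
    -- to 1 should be at vertex `v` after `v` steps.
    outerFace? o = dec⇒maybe (Fin.all? λ v → tail (iterate faceStep o (toℕ v)) Fin.≟ v) >>= λ visits →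
      just λ _ → o , λ v _ → iterate faceStep o (toℕ v) , (toℕ v , refl) , visits v

  outerplanar? : Dart G → Maybe (Outerplanar G)
  outerplanar? o = rotation? >>= λ ρ → connected? >>= λ connected →
    planar? ρ connected o >>= λ planar → outerFace? ρ connected o >>= λ outer → just (ρ , planar , outer)

-- The extremal graphs.

to-witness : ∀ {A : Set} (m : Maybe A) → is-just m ≡ true → A
to-witness (just x) _ = x

decided : ∀ {A : Set} (a? : Dec A) → does a? ≡ true → A
decided (yes a) _ = a

isNeighbour : ∀ {n} → Vec (List ℕ) n → Fin n → Fin n → Bool
isNeighbour table u v = any (toℕ v ≡ᵇ_) (lookup table u)

symmetric? : ∀ {n} (table : Vec (List ℕ) n) → Dec (∀ u v → isNeighbour table u v ≡ isNeighbour table v u)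
symmetric? table = Fin.all? λ u → Fin.all? λ v → isNeighbour table u v Bool.≟ isNeighbour table v u

irreflexive? : ∀ {n} (table : Vec (List ℕ) n) → Dec (∀ v → isNeighbour table v v ≡ false)
irreflexive? table = Fin.all? λ v → isNeighbour table v v Bool.≟ false

fromNeighbours : ∀ {n} (table : Vec (List ℕ) n) → does (symmetric? table) ≡ true → does (irreflexive? table) ≡ true → Graph
fromNeighbours {n} table symmetric irreflexive = record
  { order      = n
  ; adjacent   = isNeighbour table
  ; adj-sym    = decided (symmetric? table) symmetric
  ; adj-irrefl = decided (irreflexive? table) irreflexive
  }

triangle pentagon : Graph
triangle = fromNeighbours ((1 ∷ 2 ∷ []) ∷ (0 ∷ 2 ∷ []) ∷ (0 ∷ 1 ∷ []) ∷ []) refl refl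
pentagon = fromNeighbours
  ((1 ∷ 4 ∷ []) ∷ (0 ∷ 2 ∷ []) ∷ (1 ∷ 3 ∷ []) ∷ (2 ∷ 4 ∷ []) ∷ (0 ∷ 3 ∷ []) ∷ []) refl refl

-- Found by a computer search; the vertices are numbered along the outer face.
fans : Graph
fans = fromNeighbours
  ( (1 ∷ 4 ∷ 16 ∷ []) ∷ (0 ∷ 2 ∷ 4 ∷ []) ∷ (1 ∷ 3 ∷ 4 ∷ []) ∷ (2 ∷ 4 ∷ [])
  ∷ (0 ∷ 1 ∷ 2 ∷ 3 ∷ 5 ∷ 7 ∷ 13 ∷ 14 ∷ 15 ∷ 16 ∷ []) ∷ (4 ∷ 6 ∷ 7 ∷ []) ∷ (5 ∷ 7 ∷ [])
  ∷ (4 ∷ 5 ∷ 6 ∷ 8 ∷ 9 ∷ 10 ∷ 11 ∷ []) ∷ (7 ∷ 9 ∷ []) ∷ (7 ∷ 8 ∷ 10 ∷ []) ∷ (7 ∷ 9 ∷ 11 ∷ [])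
  ∷ (7 ∷ 10 ∷ 12 ∷ 13 ∷ []) ∷ (11 ∷ 13 ∷ []) ∷ (4 ∷ 11 ∷ 12 ∷ 14 ∷ []) ∷ (4 ∷ 13 ∷ 15 ∷ [])
  ∷ (4 ∷ 14 ∷ 16 ∷ []) ∷ (0 ∷ 4 ∷ 15 ∷ []) ∷ []) refl refl

triangle-outerplanar : Outerplanar triangle
triangle-outerplanar = to-witness (Certificate.outerplanar? triangle (dart (# 0) (# 1) tt)) refl

pentagon-outerplanar : Outerplanar pentagon
pentagon-outerplanar = to-witness (Certificate.outerplanar? pentagon (dart (# 0) (# 1) tt)) refl

-- Refuting unique-maximum colourings by backtracking.

-- Backtracking over partial colourings with colours 0, …, t; an uncoloured vertex may still
-- get any colour.
module Backtracking (G : Graph) (t : ℕ) where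
  open Graph G using (order; adjacent; N[_])

  Partial : Set
  Partial = Vec (Maybe ℕ) order

  -- A necessary condition: it holds whenever some completion with colours at most `t` makes the
  -- inequality true.
  lessThan : Maybe ℕ → Maybe ℕ → Bool
  lessThan nothing  _        = true
  lessThan (just a) nothing  = a <ᵇ t
  lessThan (just a) (just b) = a <ᵇ b

  differs : Maybe ℕ → Maybe ℕ → Bool
  differs (just a) (just b) = not (a ≡ᵇ b)
  differs _        _        = true

  coloured : Partial → List (Vertex G) → List (Vertex G × Maybe ℕ)
  coloured ρ = map λ y → y , lookup ρ y

  dominates : List (Vertex G × Maybe ℕ) → Vertex G × Maybe ℕ → Bool
  dominates ys (z , b) = all (λ (y , a) → lessThan a b ∨ does (y Fin.≟ z)) ys

  hasTop : List (Vertex G × Maybe ℕ) → Bool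
  hasTop ys = any (dominates ys) ys

  record Stage : Set where
    constructor stage
    field
      vertex         : Vertex G
      neighbours     : List (Vertex G)
      neighbourhoods : List (List (Vertex G))

  consistent : Partial → Stage → Bool
  consistent ρ (stage v us wss) =
    all (λ u → differs (lookup ρ v) (lookup ρ u)) us ∧ all (λ ws → hasTop (coloured ρ ws)) wss

  search : Partial → List Stage → Bool
  search ρ [] = true
  search ρ (s ∷ ss) = any (λ a → attempt (ρ [ Stage.vertex s ]≔ just a) s ss) (upTo (suc t))
    where
    attempt : Partial → Stage → List Stage → Bool
    attempt ρ s ss = consistent ρ s ∧ search ρ ss

  neighboursOf : Vertex G → List (Vertex G)
  neighboursOf v = filter (λ u → T? (adjacent v u)) (allFin order)

  neighbourhoodOf : Vertex G → List (Vertex G)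
  neighbourhoodOf v = v ∷ neighboursOf v

  stageAt : Vertex G → Stage
  stageAt v = stage v (neighboursOf v) (map neighbourhoodOf (neighbourhoodOf v))

  opaque
    -- Opaque, so that mentioning it does not start the search; for `fans` it is run in
    -- `fans-uncolourable`.
    colourable : List (Vertex G) → Bool
    colourable vs = search (replicate order nothing) (map stageAt vs)

  module _ (f : Vertex G → ℕ) (f≤t : ∀ v → f v ≤ t) (proper : ∀ {u v} → Adj G u v → f u ≢ f v)
    (unique-max : ∀ v → ∃ λ z → N[ v ] z × (∀ y → N[ v ] y → y ≢ z → f y < f z)) where

    _Extends_ : Maybe ℕ → ℕ → Set
    m Extends a = m ≡ nothing ⊎ m ≡ just a

    Agrees : Partial → Set
    Agrees ρ = ∀ v → lookup ρ v Extends f v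

    agrees-update : ∀ ρ v → Agrees ρ → Agrees (ρ [ v ]≔ just (f v))
    agrees-update ρ v agrees u with u Fin.≟ v
    ... | yes refl = inj₂ (Vec.lookup∘updateAt v ρ)
    ... | no u≢v = subst (_Extends f u) (sym (Vec.lookup∘updateAt′ u v u≢v ρ)) (agrees u)

    lessThan-complete : ∀ {m n} y z → m Extends f y → n Extends f z → f y < f z → T (lessThan m n)
    lessThan-complete y z (inj₁ refl) _ _ = tt
    lessThan-complete y z (inj₂ refl) (inj₁ refl) fy<fz = ℕ.<⇒<ᵇ (ℕ.<-≤-trans fy<fz (f≤t z))
    lessThan-complete y z (inj₂ refl) (inj₂ refl) fy<fz = ℕ.<⇒<ᵇ fy<fz

    differs-complete : ∀ {m n} u v → m Extends f u → n Extends f v → f u ≢ f v → T (differs m n)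
    differs-complete u v (inj₁ refl) _ _ = tt
    differs-complete u v (inj₂ refl) (inj₁ refl) _ = tt
    differs-complete u v (inj₂ refl) (inj₂ refl) fu≢fv with f u ≡ᵇ f v in eq
    ... | true = fu≢fv (ℕ.≡ᵇ⇒≡ (f u) (f v) (subst T (sym eq) tt))
    ... | false = tt

    ∈-neighbours⁺ : ∀ {v u} → Adj G v u → u ∈ neighboursOf v
    ∈-neighbours⁺ {v} vu = ∈-filter⁺ (λ u → T? (adjacent v u)) (∈-allFin _) vu

    ∈-neighbours⁻ : ∀ {v u} → u ∈ neighboursOf v → Adj G v u
    ∈-neighbours⁻ {v} u∈ = proj₂ (∈-filter⁻ (λ u → T? (adjacent v u)) {xs = allFin order} u∈)

    ∈-neighbourhood⁺ : ∀ {v u} → N[ v ] u → u ∈ neighbourhoodOf v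
    ∈-neighbourhood⁺ (inj₁ u≡v) = here u≡v
    ∈-neighbourhood⁺ (inj₂ vu) = there (∈-neighbours⁺ vu)

    ∈-neighbourhood⁻ : ∀ {v u} → u ∈ neighbourhoodOf v → N[ v ] u
    ∈-neighbourhood⁻ (here u≡v) = inj₁ u≡v
    ∈-neighbourhood⁻ (there u∈) = inj₂ (∈-neighbours⁻ u∈)

    hasTop-complete : ∀ ρ → Agrees ρ → ∀ v → T (hasTop (coloured ρ (neighbourhoodOf v)))
    hasTop-complete ρ agrees v with unique-max v
    ... | z , z∈ , greatest = any⁺ (dominates ys) (lose (∈-map⁺ (λ y → y , lookup ρ y) (∈-neighbourhood⁺ z∈))
      (all⁻ (λ (y , a) → lessThan a (lookup ρ z) ∨ does (y Fin.≟ z)) (map⁺ (All.tabulate λ {y} → less-z y))))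
      where
      ys = coloured ρ (neighbourhoodOf v)
      less-z : ∀ y → y ∈ neighbourhoodOf v → T (lessThan (lookup ρ y) (lookup ρ z) ∨ does (y Fin.≟ z))
      less-z y y∈ with y Fin.≟ z
      ... | yes _ = Equivalence.from T-∨ (inj₂ tt)
      ... | no y≢z = Equivalence.from T-∨ (inj₁ (lessThan-complete y z (agrees y) (agrees z) (greatest y (∈-neighbourhood⁻ y∈) y≢z)))

    consistent-complete : ∀ ρ → Agrees ρ → ∀ v → T (consistent ρ (stageAt v))
    consistent-complete ρ agrees v = Equivalence.from T-∧
      ( all⁻ (λ u → differs (lookup ρ v) (lookup ρ u)) (All.tabulate λ {u} u∈ → differs-complete v u (agrees v) (agrees u) (proper (∈-neighbours⁻ u∈)))
      , all⁻ (λ ws → hasTop (coloured ρ ws)) all-topped)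
      where
      all-topped : All (λ ws → T (hasTop (coloured ρ ws))) (map neighbourhoodOf (neighbourhoodOf v))
      all-topped = map⁺ (All.tabulate λ {w} _ → hasTop-complete ρ agrees w)

    -- The branch that follows `f` passes every test. A failed search therefore excludes all such
    -- `f`, and nothing has to be proved about successful ones.
    search-complete : ∀ ρ → Agrees ρ → ∀ vs → T (search ρ (map stageAt vs))
    search-complete ρ agrees [] = tt
    search-complete ρ agrees (v ∷ vs) = any⁺ _ (lose (∈-upTo⁺ (s≤s (f≤t v)))
      (Equivalence.from T-∧ (consistent-complete ρ′ agrees′ v , search-complete ρ′ agrees′ vs)))
      where
      ρ′ = ρ [ v ]≔ just (f v)
      agrees′ = agrees-update ρ v agrees

    opaque
      unfolding colourable

      colourable-complete : ∀ vs → T (colourable vs)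
      colourable-complete = search-complete (replicate order nothing) (λ v → inj₁ (Vec.lookup-replicate v nothing))

  pUMc⇒colourable : ∀ {j} → j ≤ suc t → ∃ (pUMc G j) → ∀ vs → T (colourable vs)
  pUMc⇒colourable j≤1+t (c , proper , um) = colourable-complete (toℕ ∘ c)
    (λ v → ℕ.s≤s⁻¹ (ℕ.≤-trans (Fin.toℕ<n (c v)) j≤1+t))
    (λ {u} {v} uv eq → proper u v uv (Fin.toℕ-injective eq))
    λ v → let a , (_ , maximal) , z , (z∈ , cz≡a) , unique = um v in z , z∈ , λ y y∈ y≢z →
      subst (λ b → toℕ (c y) < toℕ b) (sym cz≡a)
        (ℕ.≤∧≢⇒< (maximal y y∈) λ cy≡a → y≢z (sym (unique (y∈ , Fin.toℕ-injective cy≡a))))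

-- Lower bounds.

injective-colours : ∀ {G k} (c : Coloring G k) → (∀ u v → u ≢ v → c u ≢ c v) → Graph.order G ≤ k
injective-colours c separates = Fin.injective⇒≤ {f = c} λ {u} {v} cu≡cv → inj u v cu≡cv
  where
  inj : ∀ u v → c u ≡ c v → u ≡ v
  inj u v cu≡cv with u Fin.≟ v
  ... | yes u≡v = u≡v
  ... | no u≢v = contradiction cu≡cv (separates u v u≢v)

triangle-lower : ∀ j → ∃ (pCFc triangle j) → 3 ≤ j
triangle-lower j (c , proper , _) = injective-colours {triangle} c λ u v u≢v → proper u v (complete u v u≢v)
  where
  complete : ∀ u v → u ≢ v → Adj triangle u v
  complete = decided (Fin.all? λ u → Fin.all? λ v → ¬? (u Fin.≟ v) →-dec T? (Graph.adjacent triangle u v)) refl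

-- Two vertices of the pentagon are adjacent or form the whole neighbourhood of a third. In the
-- latter case equal colours would leave that neighbourhood without a colour appearing once, so all
-- five colours differ.
pentagon-lower : ∀ j → ∃ (pCFo pentagon j) → 5 ≤ j
pentagon-lower j (c , proper , cf) = injective-colours {pentagon} c separated
  where
  _~_ : Vertex pentagon → Vertex pentagon → Set
  _~_ = Adj pentagon
  pairs : ∀ u v → u ≢ v → u ~ v ⊎ ∃ λ w → w ~ u × w ~ v × (∀ y → w ~ y → y ≡ u ⊎ y ≡ v)
  pairs = decided (Fin.all? λ u → Fin.all? λ v → ¬? (u Fin.≟ v) →-dec (adj? u v ⊎-dec
    Fin.any? λ w → adj? w u ×-dec adj? w v ×-dec Fin.all? λ y → adj? w y →-dec ((y Fin.≟ u) ⊎-dec (y Fin.≟ v)))) refl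
    where
    adj? = λ u v → T? (Graph.adjacent pentagon u v)
  separated : ∀ u v → u ≢ v → c u ≢ c v
  separated u v u≢v cu≡cv with pairs u v u≢v
  ... | inj₁ uv = proper u v uv cu≡cv
  ... | inj₂ (w , wu , wv , only) with cf w
  ... | a , y , (wy , cy≡a) , unique with only y wy
  ... | inj₁ refl = u≢v (unique (wv , trans (sym cu≡cv) cy≡a))
  ... | inj₂ refl = u≢v (sym (unique (wu , trans cu≡cv cy≡a)))

-- Chosen to keep the search short.
searchOrder : List (Vertex fans)
searchOrder = # 13 ∷ # 14 ∷ # 4 ∷ # 12 ∷ # 11 ∷ # 7 ∷ # 10 ∷ # 5 ∷ # 6 ∷ # 15 ∷ # 9 ∷ # 16 ∷ # 0 ∷ # 1 ∷ # 2 ∷ # 8 ∷ # 3 ∷ []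

opaque
  unfolding Backtracking.colourable

  fans-uncolourable : Backtracking.colourable fans 3 searchOrder ≡ false
  fans-uncolourable = refl

fans-lower : ∀ j → ∃ (pUMc fans j) → 5 ≤ j
-- The bound 3 on the colours 0, ..., 3 stands for four colours, and covers fewer as well.
fans-lower j coloured = ℕ.≰⇒> λ j≤4 →
  subst T fans-uncolourable (Backtracking.pUMc⇒colourable fans 3 j≤4 coloured searchOrder)

fans-outerplanar : Outerplanar fans
fans-outerplanar = to-witness (Certificate.outerplanar? fans (dart (# 0) (# 1) tt)) refl

-- Closure of the families and conclusion.

opaque
  unfolding Types.compose Types._⊑_ Types.rooted Families.bases

  -- The family has 17 types, two of them bases: `attached` is evaluated on 289 pairs and `detached`
  -- on 34.
  open-closed : Types.Family.closedUnderComposition false openKinds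
    (Families.bases false openKinds) (Families.family false openKinds) ≡ true
  open-closed = refl

  closed-closed : Types.Family.closedUnderComposition true closedKinds
    (Families.bases true closedKinds) (Families.family true closedKinds) ≡ true
  closed-closed = refl

closedFamily : ∀ closed kinds → Types.Family.closedUnderComposition closed kinds
  (Families.bases closed kinds) (Families.family closed kinds) ≡ true → ClosedFamily 5 closed
closedFamily closed kinds check = record
  { kinds  = kinds
  ; c₀     = 0F
  ; 𝓑      = bases
  ; 𝓕      = family
  ; 𝓑⊆𝓕    = bases⊆family
  ; e      = empty
  ; e∈𝓑    = empty∈bases
  ; e-idle = empty-idle
  ; check  = Equivalence.from T-≡ check
  }
  where open Families closed kinds

theorem1p4 : χMax pCFo (Outerplanar ∩ NoIsolatedVertices) 5 ×
    χMax pCFc Outerplanar 3 ×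
    χMax pUMo (Outerplanar ∩ NoIsolatedVertices) 5 ×
    χMax pUMc Outerplanar 5
theorem1p4 =
  -- A unique maximum is in particular a colour appearing once. Hence (a) and (c) share the upper
  -- bound from unique maxima and the lower bound from conflict-free colourings of the pentagon.
  DecidableColoring.χMax-intro pCFo-decidable {Outerplanar ∩ NoIsolatedVertices} {5} (λ G G∈ → let c , um = pUMo-5 G G∈ in c , pUMo⇒pCFo {G} um)
    (pentagon , pentagon∈ , pentagon-lower) ,
  DecidableColoring.χMax-intro pCFc-decidable {Outerplanar} {3} (λ G → outerplanar-pCFc)
    (triangle , triangle-outerplanar , triangle-lower) ,
  DecidableColoring.χMax-intro pUMo-decidable {Outerplanar ∩ NoIsolatedVertices} {5} pUMo-5
    (pentagon , pentagon∈ , λ j (c , um) → pentagon-lower j (c , pUMo⇒pCFo {pentagon} um)) ,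
  DecidableColoring.χMax-intro pUMc-decidable {Outerplanar} {5}
    (λ G outerplanar → outerplanar-pUMc {G} outerplanar (closedFamily true closedKinds closed-closed))
    (fans , fans-outerplanar , fans-lower)
  where
  pUMo-5 : ∀ G → (Outerplanar ∩ NoIsolatedVertices) G → ∃ (pUMo G 5)
  pUMo-5 G (outerplanar , non-isolated) = outerplanar-pUMo outerplanar (closedFamily false openKinds open-closed) non-isolated
  pentagon∈ : (Outerplanar ∩ NoIsolatedVertices) pentagon
  pentagon∈ = pentagon-outerplanar ,
    decided (Fin.all? λ v → Fin.any? λ u → T? (Graph.adjacent pentagon v u)) refl
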